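{- For every sufficiently small constant $\varepsilon>0$, sample-based convexity testing in $\{0,\pm1\}^n$ (with parameter $\varepsilon$) with one-sided error requires $3^{\Theta(n)}$ samples. That is, there is $\varepsilon_0>0$ such that for every $\varepsilon\in(0,\varepsilon_0]$ there exist constants $0<c\le C$ and $n_0$ such that for all $n\ge n_0$: every sample-based convexity tester with one-sided error and parameter $\varepsilon$ uses at least $3^{cn}$ samples, and there exists such a tester using at most $3^{Cn}$ samples.
   Context: A set $S\subseteq\{0,\pm1\}^n$ is convex if $S=\mathrm{Conv}(S)\cap\{0,\pm1\}^n$, where $\mathrm{Conv}(S)\subseteq\mathbb{R}^n$ is the convex hull. For $S,T\subseteq\{0,\pm1\}^n$, $\mathrm{dist}(S,T)=|S\,\Delta\,T|/3^n$; $S$ is $\varepsilon$-far from convex if $\mathrm{dist}(S,T)\ge\varepsilon$ for every convex $T\subseteq\{0,\pm1\}^n$. A convexity tester with one-sided error and parameter $\varepsilon$ is a randomized algorithm with membership-oracle access to an unknown $S\subseteq\{0,\pm1\}^n$ that accepts with probability $1$ if $S$ is convex, and rejects with probability at least $2/3$ if $S$ is $\varepsilon$-far from convex. It is sample-based if its queries are independent uniformly random points of $\{0,\pm1\}^n$. -}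

module Defs where

open import Data.Bool using (Bool; true; false; _xor_)
open import Data.Fin using (Fin)
open import Data.Integer using (+_; ∣_∣)
open import Data.List using (List; []; _∷_; length; foldr; filterᵇ; cartesianProductWith)
open import Data.List.Relation.Unary.All using (All)
open import Data.Nat as ℕ using (ℕ; zero; suc)
import Data.Nat.Properties as ℕₚ
open import Data.Product using (∃-syntax; _×_; _,_; proj₁; proj₂)
open import Data.Rational as ℚ using (ℚ; 0ℚ; 1ℚ; ½; ↥_; ↧ₙ_)
import Data.Rational.Properties as ℚₚ
open import Data.Rational.Solver using (module +-*-Solver)
open import Data.Vec as Vec using (Vec; []; _∷_; lookup)
open import Function using (_⇔_)
open import Relation.Binary.PropositionalEquality

-- ℝ is the setoid of Cauchy sequences of rationals under _≃ℝ_.  Only sums and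
-- rational multiples are defined: every product needed has a rational factor.

IsCauchy : (ℕ → ℚ) → Set
IsCauchy x = ∀ δ → 0ℚ ℚ.< δ →
  ∃[ N ] (∀ i j → N ℕ.≤ i → N ℕ.≤ j → ℚ.∣ x i ℚ.- x j ∣ ℚ.≤ δ)

record ℝ : Set where
  constructor mkℝ
  field
    seq    : ℕ → ℚ
    cauchy : IsCauchy seq

open ℝ public

infix 4 _≤ℝ_ _<ℝ_ _≃ℝ_

_≤ℝ_ : ℝ → ℝ → Set
x ≤ℝ y = ∀ δ → 0ℚ ℚ.< δ → ∃[ N ] (∀ i → N ℕ.≤ i → seq x i ℚ.≤ seq y i ℚ.+ δ)

_<ℝ_ : ℝ → ℝ → Set
x <ℝ y = ∃[ δ ] (0ℚ ℚ.< δ × ∃[ N ] (∀ i → N ℕ.≤ i → seq x i ℚ.+ δ ℚ.≤ seq y i))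

_≃ℝ_ : ℝ → ℝ → Set
x ≃ℝ y = x ≤ℝ y × y ≤ℝ x

fromℚ : ℚ → ℝ
fromℚ q = mkℝ (λ _ → q) λ δ 0<δ → 0 , λ _ _ _ _ →
  subst (ℚ._≤ δ) (cong ℚ.∣_∣ (sym (ℚₚ.+-inverseʳ q))) (ℚₚ.<⇒≤ 0<δ)

0ℝ 1ℝ : ℝ
0ℝ = fromℚ 0ℚ
1ℝ = fromℚ 1ℚ

infixl 6 _+ℝ_ _-ℝ_
infixl 7 _·_

_+ℝ_ : ℝ → ℝ → ℝ
x +ℝ y = mkℝ (λ i → seq x i ℚ.+ seq y i) proof
  where
  regroup : ∀ a b c d → (a ℚ.+ b) ℚ.- (c ℚ.+ d) ≡ (a ℚ.- c) ℚ.+ (b ℚ.- d)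
  regroup = solve 4 (λ a b c d → (a :+ b) :- (c :+ d) := (a :- c) :+ (b :- d)) refl
    where open +-*-Solver
  halves : ∀ δ → ½ ℚ.* δ ℚ.+ ½ ℚ.* δ ≡ δ
  halves δ = trans (sym (ℚₚ.*-distribʳ-+ δ ½ ½)) (ℚₚ.*-identityˡ δ)
  proof : IsCauchy (λ i → seq x i ℚ.+ seq y i)
  proof δ 0<δ = N₁ ℕ.⊔ N₂ , λ i j N≤i N≤j → begin
      ℚ.∣ (seq x i ℚ.+ seq y i) ℚ.- (seq x j ℚ.+ seq y j) ∣
        ≡⟨ cong ℚ.∣_∣ (regroup (seq x i) (seq y i) (seq x j) (seq y j)) ⟩
      ℚ.∣ (seq x i ℚ.- seq x j) ℚ.+ (seq y i ℚ.- seq y j) ∣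
        ≤⟨ ℚₚ.∣p+q∣≤∣p∣+∣q∣ (seq x i ℚ.- seq x j) (seq y i ℚ.- seq y j) ⟩
      ℚ.∣ seq x i ℚ.- seq x j ∣ ℚ.+ ℚ.∣ seq y i ℚ.- seq y j ∣
        ≤⟨ ℚₚ.+-mono-≤
             (proj₂ cx i j (ℕₚ.m⊔n≤o⇒m≤o N₁ N₂ N≤i) (ℕₚ.m⊔n≤o⇒m≤o N₁ N₂ N≤j))
             (proj₂ cy i j (ℕₚ.m⊔n≤o⇒n≤o N₁ N₂ N≤i) (ℕₚ.m⊔n≤o⇒n≤o N₁ N₂ N≤j)) ⟩
      ½ ℚ.* δ ℚ.+ ½ ℚ.* δ
        ≡⟨ halves δ ⟩
      δ ∎
    where
    open ℚₚ.≤-Reasoning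
    0<½δ : 0ℚ ℚ.< ½ ℚ.* δ
    0<½δ = subst (ℚ._< ½ ℚ.* δ) (ℚₚ.*-zeroʳ ½) (ℚₚ.*-monoʳ-<-pos ½ 0<δ)
    cx = cauchy x (½ ℚ.* δ) 0<½δ
    cy = cauchy y (½ ℚ.* δ) 0<½δ
    N₁ = proj₁ cx
    N₂ = proj₁ cy

_·_ : ℚ → ℝ → ℝ
q · x = mkℝ (λ i → q ℚ.* seq x i) proof
  where
  factor : ∀ a b c → a ℚ.* b ℚ.- a ℚ.* c ≡ a ℚ.* (b ℚ.- c)
  factor = solve 3 (λ a b c → a :* b :- a :* c := a :* (b :- c)) refl
    where open +-*-Solver
  r : ℚ
  r = 1ℚ ℚ.+ ℚ.∣ q ∣
  instance
    r⁺ : ℚ.Positive r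
    r⁺ = ℚₚ.pos+nonNeg⇒pos 1ℚ ℚ.∣ q ∣ {{ℚₚ.∣-∣-nonNeg q}}
    r≢0 : ℚ.NonZero r
    r≢0 = ℚₚ.pos⇒nonZero r
    r⁻¹⁺ : ℚ.Positive (ℚ.1/ r)
    r⁻¹⁺ = ℚₚ.1/pos⇒pos r
    ∣q∣⁺ : ℚ.NonNegative ℚ.∣ q ∣
    ∣q∣⁺ = ℚₚ.∣-∣-nonNeg q
  proof : IsCauchy (λ i → q ℚ.* seq x i)
  proof δ 0<δ = proj₁ cx , λ i j N≤i N≤j → begin
      ℚ.∣ q ℚ.* seq x i ℚ.- q ℚ.* seq x j ∣
        ≡⟨ cong ℚ.∣_∣ (factor q (seq x i) (seq x j)) ⟩
      ℚ.∣ q ℚ.* (seq x i ℚ.- seq x j) ∣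
        ≡⟨ ℚₚ.∣p*q∣≡∣p∣*∣q∣ q (seq x i ℚ.- seq x j) ⟩
      ℚ.∣ q ∣ ℚ.* ℚ.∣ seq x i ℚ.- seq x j ∣
        ≤⟨ ℚₚ.*-monoˡ-≤-nonNeg ℚ.∣ q ∣ (proj₂ cx i j N≤i N≤j) ⟩
      ℚ.∣ q ∣ ℚ.* η
        ≤⟨ ℚₚ.*-monoʳ-≤-nonNeg η {{ℚ.nonNegative (ℚₚ.<⇒≤ 0<η)}} ∣q∣≤r ⟩
      r ℚ.* η
        ≡⟨ ℚₚ.*-assoc r (ℚ.1/ r) δ ⟨
      r ℚ.* ℚ.1/ r ℚ.* δ
        ≡⟨ cong (ℚ._* δ) (ℚₚ.*-inverseʳ r) ⟩
      1ℚ ℚ.* δ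
        ≡⟨ ℚₚ.*-identityˡ δ ⟩
      δ ∎
    where
    open ℚₚ.≤-Reasoning
    η : ℚ
    η = ℚ.1/ r ℚ.* δ
    0<η : 0ℚ ℚ.< η
    0<η = subst (ℚ._< η) (ℚₚ.*-zeroʳ (ℚ.1/ r)) (ℚₚ.*-monoʳ-<-pos (ℚ.1/ r) 0<δ)
    ∣q∣≤r : ℚ.∣ q ∣ ℚ.≤ r
    ∣q∣≤r = subst (ℚ._≤ r) (ℚₚ.+-identityˡ ℚ.∣ q ∣)
              (ℚₚ.+-monoˡ-≤ ℚ.∣ q ∣ {0ℚ} {1ℚ} (ℚₚ.nonNegative⁻¹ 1ℚ))
    cx = cauchy x η 0<η

_-ℝ_ : ℝ → ℝ → ℝ
x -ℝ y = x +ℝ (ℚ.- 1ℚ) · y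

Σℝ : {A : Set} → (A → ℝ) → List A → ℝ
Σℝ f = foldr (λ a s → f a +ℝ s) 0ℝ

data Trit : Set where
  −1ₜ 0ₜ +1ₜ : Trit

toℚ : Trit → ℚ
toℚ −1ₜ = ℚ.- 1ℚ
toℚ 0ₜ  = 0ℚ
toℚ +1ₜ = 1ℚ

Point : ℕ → Set
Point n = Vec Trit n

embed : ∀ {n} → Point n → Vec ℝ n
embed = Vec.map (λ t → fromℚ (toℚ t))

-- All m-tuples with entries from a list, each position chosen independently.
tuples : {A : Set} → List A → (m : ℕ) → List (Vec A m)
tuples as zero    = [] ∷ []
tuples as (suc m) = cartesianProductWith _∷_ as (tuples as m)

cube : ∀ n → List (Point n)
cube n = tuples (−1ₜ ∷ 0ₜ ∷ +1ₜ ∷ []) n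

-- A subset of the finite cube is given by its membership oracle.
Subset : ℕ → Set
Subset n = Point n → Bool

-- y is in the convex hull when it is a finite convex combination Σ w x, with
-- real weights w, of points x ∈ S; the combination is a list of pairs (w , x).
_∈Conv_ : ∀ {n} → Vec ℝ n → Subset n → Set
_∈Conv_ {n} y S = ∃[ ws ]
  ( All (λ (w , x) → 0ℝ ≤ℝ w × S x ≡ true) ws
  × Σℝ proj₁ ws ≃ℝ 1ℝ
  × (∀ (i : Fin n) → Σℝ (λ (w , x) → toℚ (lookup x i) · w) ws ≃ℝ lookup y i) )

Convex : ∀ {n} → Subset n → Set
Convex S = ∀ x → S x ≡ true ⇔ embed x ∈Conv S

_△_ : ∀ {n} → Subset n → Subset n → Subset n
(S △ T) x = S x xor T x

size : ∀ {n} → Subset n → ℕ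
size {n} S = length (filterᵇ S (cube n))

dist : ∀ {n} → Subset n → Subset n → ℚ
dist {n} S T = ℚ._/_ (+ size (S △ T)) (3 ℕ.^ n) {{ℕₚ.m^n≢0 3 n}}

Far : ∀ {n} → ℝ → Subset n → Set
Far ε S = ∀ T → Convex T → ε ≤ℝ fromℚ (dist S T)

-- A randomized algorithm that sees m labelled samples (x , S x) is given by
-- its probability, over its internal randomness, of accepting given the
-- samples.
record SampleTester (n m : ℕ) : Set where
  field
    accept   : Vec (Point n × Bool) m → ℝ
    accept≥0 : ∀ z → 0ℝ ≤ℝ accept z
    accept≤1 : ∀ z → accept z ≤ℝ 1ℝ

open SampleTester public

-- Expectation over m independent uniform points of the cube.
𝔼 : ∀ {n m} → (Vec (Point n) m → ℝ) → ℝ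
𝔼 {n} {m} f =
  ℚ._/_ (+ 1) ((3 ℕ.^ n) ℕ.^ m) {{ℕₚ.m^n≢0 (3 ℕ.^ n) m {{ℕₚ.m^n≢0 3 n}}}}
    · Σℝ f (tuples (cube n) m)

labelled : ∀ {n m} → Subset n → Vec (Point n) m → Vec (Point n × Bool) m
labelled S = Vec.map (λ x → x , S x)

PrAccept PrReject : ∀ {n m} → SampleTester n m → Subset n → ℝ
PrAccept A S = 𝔼 (λ xs → accept A (labelled S xs))
PrReject A S = 𝔼 (λ xs → 1ℝ -ℝ accept A (labelled S xs))

IsOneSidedConvexityTester : ∀ {n m} → ℝ → SampleTester n m → Set
IsOneSidedConvexityTester ε A =
    (∀ S → Convex S → PrAccept A S ≃ℝ 1ℝ)
  × (∀ S → Far ε S → fromℚ (+ 2 ℚ./ 3) ≤ℝ PrReject A S)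

-- Comparing m with 3^(c n) for rational c = p / q ≥ 0, by taking q-th powers:
-- 3^(c n) ≤ m iff 3^(p n) ≤ m^q.  Not meaningful for c < 0.

3^⟨_*_⟩≤_ : ℚ → ℕ → ℕ → Set
3^⟨ c * n ⟩≤ m = 3 ℕ.^ (∣ ↥ c ∣ ℕ.* n) ℕ.≤ m ℕ.^ (↧ₙ c)

_≤3^⟨_*_⟩ : ℕ → ℚ → ℕ → Set
m ≤3^⟨ c * n ⟩ = m ℕ.^ (↧ₙ c) ℕ.≤ 3 ℕ.^ (∣ ↥ c ∣ ℕ.* n)

{-# OPTIONS --safe #-}
-- Lower bound.  Write q ⊑ x when x agrees with q on the support of q.  A uniform
-- pair satisfies q ⊑ x with probability (5/9)^n, so m samples contain two
-- ⊑-comparable ones with probability at most m² (5/9)^n.  If no two are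
-- comparable, the labels of any S agree with the convex set obtained by removing
-- { x | q ⊑ x } for every sample q outside S: this is cut off by the inequality
-- Σ q_i x_i ≤ |supp q| - 1.  A one-sided tester accepts such samples, whatever S
-- is, and so in particular for S = { x | x₁ ≠ 0 }: a convex set differs from it on
-- each line in direction 1, so that it is 1/3-far from convex.
--
-- Upper bound.  With 3^n · 3^n samples the whole cube is seen with probability at
-- least 2/3, and then convexity of S is decided outright: by Gordan's alternative
-- over ℚ, a point is either a rational convex combination of S or strictly
-- separated from S.
module Submission where

open import Defs
open import Data.Nat using (ℕ; _≥_)
open import Data.Product using (Σ; ∃-syntax; _×_)
open import Data.Rational using (0ℚ; _<_; _≤_)

open import Algebra.Bundles using (module CommutativeRing)
import Algebra.Properties.Semiring.Mult
open import Data.Bool as Bool using (Bool; true; false; not; _∧_; _∨_; _xor_; if_then_else_)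
open import Data.Bool.Properties using (∧-conicalˡ; ∧-conicalʳ; ¬-not; xor-same)
open import Data.Empty using (⊥-elim)
open import Data.Fin using (Fin; zero; suc)
import Data.Integer as ℤ
import Data.Integer.Properties as ℤₚ
open import Data.List
  using (List; []; _∷_; _++_; map; foldr; length; filter; filterᵇ; cartesianProductWith)
open import Data.List.Membership.Propositional using (_∈_; find; lose)
open import Data.List.Membership.Propositional.Properties
  using (∈-cartesianProductWith⁺; ∈-filter⁺; ∈-map⁺)
import Data.List.Properties as Listₚ
open import Data.List.Relation.Unary.All as All using (All; []; _∷_)
import Data.List.Relation.Unary.All.Properties as Allₚ
open import Data.List.Relation.Unary.Any using (Any; any?; here; there; satisfied)
open import Data.Nat as ℕ using (zero; suc; _+_; _*_; _^_; z≤n; s≤s)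
open import Data.Nat.ListAction using (sum)
open import Data.Nat.ListAction.Properties using (sum-++)
import Data.Nat.Properties as ℕₚ
open import Data.Nat.Solver using () renaming (module +-*-Solver to ℕ-Solver)
open import Data.Product using (_,_; proj₁; proj₂)
open import Data.Rational as ℚ using (ℚ; 1ℚ; ½; toℚᵘ)
import Data.Rational.Properties as ℚₚ
open import Data.Rational.Solver using () renaming (module +-*-Solver to ℚ-Solver)
open import Data.Rational.Unnormalised as ℚᵘ using (mkℚᵘ; *≡*)
import Data.Rational.Unnormalised.Properties as ℚᵘₚ
open import Data.Sum using (_⊎_; inj₁; inj₂)
open import Data.Vec as Vec using (Vec; []; _∷_; lookup; toList)
import Data.Vec.Properties as Vecₚ
open import Function using (_∘_; mk⇔; module Equivalence)
open import Relation.Binary using (DecidableEquality; tri<; tri≈; tri>)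
open import Relation.Binary.PropositionalEquality
open import Relation.Nullary using (¬_; Dec; yes; no; does)
open import Relation.Nullary.Decidable using (_×-dec_; dec-true; dec-false; toWitness)

-- Probabilities are counts over all sample tuples, with denominators cleared into ℕ; reals enter
-- only as acceptance probabilities and hull weights. Comparisons of such reals cannot be decided,
-- and this shapes two steps. Acceptance with probability one has to yield acceptance of each single
-- tuple: an average of numbers at most 1 that equals 1 leaves no slack in any term. And hulls with
-- real weights have to be decided: Gordan's alternative gives rational weights or a rational
-- functional, and the functional excludes real weights too, because a rational threshold fits
-- strictly between its value at the point and its finitely many values on a combination.
--
-- The order ⊑ comes from the faces of the cube: the points x with q ⊑ x are those of the face
-- centred at q, and a face can be cut off by a half-space that loses no other point.
--
-- Both probability bounds are first-moment bounds. Rejection of a tuple is at most its number of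
-- comparable pairs; failure of the full-view tester on a tuple is at most its number of missing
-- points.

private
  variable
    A B C : Set
    d m n : ℕ

-- Counting in the cube

∑ : List A → (A → ℕ) → ℕ
∑ as f = sum (map f as)

∑-cong : ∀ (as : List A) {f g} → (∀ a → f a ≡ g a) → ∑ as f ≡ ∑ as g
∑-cong as eq = cong sum (Listₚ.map-cong eq as)

∑-mono : ∀ (as : List A) {f g} → (∀ a → f a ℕ.≤ g a) → ∑ as f ℕ.≤ ∑ as g
∑-mono []       le = z≤n
∑-mono (a ∷ as) le = ℕₚ.+-mono-≤ (le a) (∑-mono as le)

∑-++ : ∀ (as : List A) {bs} f → ∑ (as ++ bs) f ≡ ∑ as f + ∑ bs f
∑-++ as {bs} f = trans (cong sum (Listₚ.map-++ f as bs)) (sum-++ (map f as) (map f bs))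

∑-map : ∀ (g : A → B) as f → ∑ (map g as) f ≡ ∑ as (f ∘ g)
∑-map g as f = cong sum (sym (Listₚ.map-∘ as))

∑-const : ∀ (as : List A) k → ∑ as (λ _ → k) ≡ length as * k
∑-const []       k = refl
∑-const (a ∷ as) k = cong (k +_) (∑-const as k)

∑-+ : ∀ (as : List A) f g → ∑ as (λ a → f a + g a) ≡ ∑ as f + ∑ as g
∑-+ []       f g = refl
∑-+ (a ∷ as) f g rewrite ∑-+ as f g =
  solve 4 (λ w x y z → (w :+ x) :+ (y :+ z) := (w :+ y) :+ (x :+ z)) refl
    (f a) (g a) (∑ as f) (∑ as g)
  where open ℕ-Solver

∑-*ˡ : ∀ (as : List A) k f → ∑ as (λ a → k * f a) ≡ k * ∑ as f
∑-*ˡ []       k f = sym (ℕₚ.*-zeroʳ k)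
∑-*ˡ (a ∷ as) k f rewrite ∑-*ˡ as k f = sym (ℕₚ.*-distribˡ-+ k (f a) (∑ as f))

∑-*ʳ : ∀ (as : List A) k f → ∑ as (λ a → f a * k) ≡ ∑ as f * k
∑-*ʳ []       k f = refl
∑-*ʳ (a ∷ as) k f rewrite ∑-*ʳ as k f = sym (ℕₚ.*-distribʳ-+ k (f a) (∑ as f))

∑-swap : ∀ (as : List A) (bs : List B) (f : A → B → ℕ) →
         ∑ as (λ a → ∑ bs (f a)) ≡ ∑ bs (λ b → ∑ as (λ a → f a b))
∑-swap []       bs f = sym (trans (∑-const bs 0) (ℕₚ.*-zeroʳ (length bs)))
∑-swap (a ∷ as) bs f =
  trans (cong (∑ bs (f a) +_) (∑-swap as bs f)) (sym (∑-+ bs (f a) (λ b → ∑ as (λ a → f a b))))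

∑-cartesianProductWith : ∀ (h : A → B → C) as bs f →
  ∑ (cartesianProductWith h as bs) f ≡ ∑ as (λ a → ∑ bs (λ b → f (h a b)))
∑-cartesianProductWith h []       bs f = refl
∑-cartesianProductWith h (a ∷ as) bs f =
  trans (∑-++ (map (h a) bs) f)
        (cong₂ _+_ (∑-map (h a) bs f) (∑-cartesianProductWith h as bs f))

∑≡0⇒≡0 : ∀ {as : List A} {f a} → ∑ as f ≡ 0 → a ∈ as → f a ≡ 0
∑≡0⇒≡0 {f = f} eq (here {x} refl) = ℕₚ.m+n≡0⇒m≡0 (f x) eq
∑≡0⇒≡0 {f = f} eq (there {x} a∈) = ∑≡0⇒≡0 (ℕₚ.m+n≡0⇒n≡0 (f x) eq) a∈

𝟙 : Bool → ℕ
𝟙 b = if b then 1 else 0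

length-filterᵇ : ∀ (p : A → Bool) as → length (filterᵇ p as) ≡ ∑ as (𝟙 ∘ p)
length-filterᵇ p []       = refl
length-filterᵇ p (a ∷ as) with p a
... | true  = cong suc (length-filterᵇ p as)
... | false = length-filterᵇ p as

∈-tuples : {as : List A} → (∀ a → a ∈ as) → (xs : Vec A m) → xs ∈ tuples as m
∈-tuples all []       = here refl
∈-tuples all (x ∷ xs) = ∈-cartesianProductWith⁺ _∷_ (all x) (∈-tuples all xs)

∈-cube : (x : Point n) → x ∈ cube n
∈-cube = ∈-tuples λ where
  −1ₜ → here refl
  0ₜ  → there (here refl)
  +1ₜ → there (there (here refl))

length-tuples : ∀ (as : List A) m → length (tuples as m) ≡ length as ^ m
length-tuples as zero    = refl
length-tuples as (suc m) =
  trans (go as) (cong (length as *_) (length-tuples as m))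
  where
  go : ∀ bs → length (cartesianProductWith Vec._∷_ bs (tuples as m))
            ≡ length bs * length (tuples as m)
  go []       = refl
  go (b ∷ bs) = trans (Listₚ.length-++ (map (b ∷_) (tuples as m)))
                      (cong₂ _+_ (Listₚ.length-map (b ∷_) (tuples as m)) (go bs))

length-cube : ∀ n → length (cube n) ≡ 3 ^ n
length-cube = length-tuples _

∑-cube-suc : ∀ n (f : Point (suc n) → ℕ) → ∑ (cube (suc n)) f ≡
  ∑ (cube n) (f ∘ (−1ₜ ∷_)) + (∑ (cube n) (f ∘ (0ₜ ∷_)) + ∑ (cube n) (f ∘ (+1ₜ ∷_)))
∑-cube-suc n f =
  trans (∑-cartesianProductWith _∷_ (−1ₜ ∷ 0ₜ ∷ +1ₜ ∷ []) (cube n) f)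
        (cong (λ k → ∑ (cube n) (f ∘ (−1ₜ ∷_)) + (∑ (cube n) (f ∘ (0ₜ ∷_)) + k))
              (ℕₚ.+-identityʳ _))

_≟ₜ_ : DecidableEquality Trit
−1ₜ ≟ₜ −1ₜ = yes refl
−1ₜ ≟ₜ 0ₜ  = no λ ()
−1ₜ ≟ₜ +1ₜ = no λ ()
0ₜ  ≟ₜ −1ₜ = no λ ()
0ₜ  ≟ₜ 0ₜ  = yes refl
0ₜ  ≟ₜ +1ₜ = no λ ()
+1ₜ ≟ₜ −1ₜ = no λ ()
+1ₜ ≟ₜ 0ₜ  = no λ ()
+1ₜ ≟ₜ +1ₜ = yes refl

_≟ₚ_ : DecidableEquality (Point n)
_≟ₚ_ = Vecₚ.≡-dec _≟ₜ_

∑-≟ₚ : (x : Point n) → ∑ (cube n) (λ a → 𝟙 (does (x ≟ₚ a))) ≡ 1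
∑-≟ₚ [] = refl
∑-≟ₚ {suc n} (s ∷ x) = trans (∑-cube-suc n _) (step s)
  where
  none : ∑ (cube n) (λ _ → 0) ≡ 0
  none = trans (∑-const (cube n) 0) (ℕₚ.*-zeroʳ (length (cube n)))
  step : ∀ s → ∑ (cube n) (λ a → 𝟙 (does ((s ∷ x) ≟ₚ (−1ₜ ∷ a))))
           + (∑ (cube n) (λ a → 𝟙 (does ((s ∷ x) ≟ₚ (0ₜ ∷ a))))
           + ∑ (cube n) (λ a → 𝟙 (does ((s ∷ x) ≟ₚ (+1ₜ ∷ a))))) ≡ 1
  step −1ₜ = cong₂ _+_ (∑-≟ₚ x) (cong₂ _+_ none none)
  step 0ₜ  = cong₂ _+_ none (cong₂ _+_ (∑-≟ₚ x) none)
  step +1ₜ = cong₂ _+_ none (cong₂ _+_ none (∑-≟ₚ x))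

-- Coupon collecting: the expected number of unseen points

seen : Vec (Point n) m → Subset n
seen []       x = false
seen (y ∷ ys) x = does (x ≟ₚ y) ∨ seen ys x

missing : Vec (Point n) m → ℕ
missing {n} ys = ∑ (cube n) (λ x → 𝟙 (not (seen ys x)))

-- `∑-≟ₚ` accounts for the one point equal to `x`. Here and below, `3 ^ n ≡ suc k` names the number
-- of remaining points without truncated subtraction.
∑-others : ∀ k (x : Point n) → 3 ^ n ≡ suc k →
           ∑ (cube n) (λ y → 𝟙 (not (does (x ≟ₚ y)))) ≡ k
∑-others {n} k x 3^n≡ = ℕₚ.suc-injective (begin
  1 + ∑ (cube n) (λ y → 𝟙 (not (does (x ≟ₚ y))))
    ≡⟨ cong (_+ ∑ (cube n) (λ y → 𝟙 (not (does (x ≟ₚ y))))) (∑-≟ₚ x) ⟨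
  ∑ (cube n) (λ y → 𝟙 (does (x ≟ₚ y))) + ∑ (cube n) (λ y → 𝟙 (not (does (x ≟ₚ y))))
    ≡⟨ ∑-+ (cube n) _ _ ⟨
  ∑ (cube n) (λ y → 𝟙 (does (x ≟ₚ y)) + 𝟙 (not (does (x ≟ₚ y))))
    ≡⟨ ∑-cong (cube n) (λ y → excluded (does (x ≟ₚ y))) ⟩
  ∑ (cube n) (λ _ → 1)
    ≡⟨ ∑-const (cube n) 1 ⟩
  length (cube n) * 1
    ≡⟨ trans (ℕₚ.*-identityʳ _) (length-cube n) ⟩
  3 ^ n
    ≡⟨ 3^n≡ ⟩
  suc k ∎)
  where
  open ≡-Reasoning
  excluded : ∀ b → 𝟙 b + 𝟙 (not b) ≡ 1
  excluded true  = refl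
  excluded false = refl

-- The positions are independent, and each contributes a factor `k` for the points other than `x`.
∑-unseen : ∀ k (x : Point n) m → 3 ^ n ≡ suc k →
           ∑ (tuples (cube n) m) (λ ys → 𝟙 (not (seen ys x))) ≡ k ^ m
∑-unseen k x zero 3^n≡ = refl
∑-unseen {n} k x (suc m) 3^n≡ = begin
  ∑ (tuples (cube n) (suc m)) (λ ys → 𝟙 (not (seen ys x)))
    ≡⟨ ∑-cartesianProductWith _∷_ (cube n) (tuples (cube n) m) _ ⟩
  ∑ (cube n) (λ y → ∑ (tuples (cube n) m) (λ ys → 𝟙 (not (does (x ≟ₚ y) ∨ seen ys x))))
    ≡⟨ ∑-cong (cube n) (λ y → trans
         (∑-cong (tuples (cube n) m) (λ ys → factor (does (x ≟ₚ y)) (seen ys x)))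
         (∑-*ˡ (tuples (cube n) m) (𝟙 (not (does (x ≟ₚ y)))) _)) ⟩
  ∑ (cube n) (λ y → 𝟙 (not (does (x ≟ₚ y))) * ∑ (tuples (cube n) m) (λ ys → 𝟙 (not (seen ys x))))
    ≡⟨ ∑-*ʳ (cube n) _ _ ⟩
  ∑ (cube n) (λ y → 𝟙 (not (does (x ≟ₚ y)))) * ∑ (tuples (cube n) m) (λ ys → 𝟙 (not (seen ys x)))
    ≡⟨ cong₂ _*_ (∑-others k x 3^n≡) (∑-unseen k x m 3^n≡) ⟩
  k * k ^ m ∎
  where
  open ≡-Reasoning
  factor : ∀ a b → 𝟙 (not (a ∨ b)) ≡ 𝟙 (not a) * 𝟙 (not b)
  factor true  b = refl
  factor false b = sym (ℕₚ.+-identityʳ _)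

-- Linearity of expectation: exchanging the sums leaves one fixed point of the cube to be missed.
∑-missing : ∀ k m → 3 ^ n ≡ suc k → ∑ (tuples (cube n) m) missing ≡ 3 ^ n * k ^ m
∑-missing {n} k m 3^n≡ = begin
  ∑ (tuples (cube n) m) (λ ys → ∑ (cube n) (λ x → 𝟙 (not (seen ys x))))
    ≡⟨ ∑-swap (tuples (cube n) m) (cube n) (λ ys x → 𝟙 (not (seen ys x))) ⟩
  ∑ (cube n) (λ x → ∑ (tuples (cube n) m) (λ ys → 𝟙 (not (seen ys x))))
    ≡⟨ ∑-cong (cube n) (λ x → ∑-unseen k x m 3^n≡) ⟩
  ∑ (cube n) (λ _ → k ^ m)
    ≡⟨ ∑-const (cube n) (k ^ m) ⟩
  length (cube n) * k ^ m
    ≡⟨ cong (_* k ^ m) (length-cube n) ⟩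
  3 ^ n * k ^ m ∎
  where open ≡-Reasoning

-- For k > 0 this is Bernoulli's inequality 1 + j/k ≤ (1 + 1/k)^j, multiplied by k^(j+1) to stay in
-- ℕ.
bernoulli : ∀ k j → j * k ^ j + k ^ suc j ℕ.≤ k * suc k ^ j
bernoulli k zero    = ℕₚ.≤-reflexive refl
bernoulli k (suc j) = begin
  suc j * k ^ suc j + k ^ suc (suc j)
    ≡⟨ solve 3 (λ j k p → (con 1 :+ j) :* (k :* p) :+ k :* (k :* p)
         := k :* (j :* p :+ k :* p) :+ k :* p) refl j k (k ^ j) ⟩
  k * (j * k ^ j + k ^ suc j) + k ^ suc j
    ≤⟨ ℕₚ.+-monoʳ-≤ _ (ℕₚ.m≤n+m (k ^ suc j) (j * k ^ j)) ⟩
  k * (j * k ^ j + k ^ suc j) + (j * k ^ j + k ^ suc j)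
    ≤⟨ ℕₚ.+-mono-≤ (ℕₚ.*-monoʳ-≤ k (bernoulli k j)) (bernoulli k j) ⟩
  k * (k * suc k ^ j) + k * suc k ^ j
    ≡⟨ solve 2 (λ k p → k :* (k :* p) :+ k :* p := k :* ((con 1 :+ k) :* p)) refl k (suc k ^ j) ⟩
  k * suc k ^ suc j ∎
  where
  open ℕₚ.≤-Reasoning
  open ℕ-Solver

-- (1 - 1/N)^N ≤ 1/2 for N = k + 1.
half-power : ∀ k → 2 * k ^ suc k ℕ.≤ suc k ^ suc k
half-power zero      = z≤n
half-power k@(suc _) = ℕₚ.*-cancelˡ-≤ k (begin
  k * (2 * k ^ suc k)
    ≤⟨ ℕₚ.m≤m+n _ (k ^ suc k) ⟩
  k * (2 * k ^ suc k) + k ^ suc k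
    ≡⟨ solve 2 (λ k p → k :* (con 2 :* p) :+ p := (con 1 :+ k) :* p :+ k :* p) refl k (k ^ suc k) ⟩
  suc k * k ^ suc k + k ^ suc (suc k)
    ≤⟨ bernoulli k (suc k) ⟩
  k * suc k ^ suc k ∎)
  where
  open ℕₚ.≤-Reasoning
  open ℕ-Solver

3*n≤2^n : ∀ n → 4 ℕ.≤ n → 3 * n ℕ.≤ 2 ^ n
3*n≤2^n (suc (suc (suc (suc n)))) (s≤s (s≤s (s≤s (s≤s _)))) = go n
  where
  open ℕₚ.≤-Reasoning
  open ℕ-Solver
  go : ∀ n → 3 * (4 + n) ℕ.≤ 2 ^ (4 + n)
  go zero    = ℕₚ.m≤m+n 12 4
  go (suc n) = begin
    3 * (5 + n)             ≤⟨ ℕₚ.m≤m+n _ (9 + 3 * n) ⟩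
    3 * (5 + n) + (9 + 3 * n) ≡⟨ solve 1 (λ n → con 3 :* (con 5 :+ n) :+ (con 9 :+ con 3 :* n)
                                    := con 2 :* (con 3 :* (con 4 :+ n))) refl n ⟩
    2 * (3 * (4 + n))       ≤⟨ ℕₚ.*-monoʳ-≤ 2 (go n) ⟩
    2 ^ (5 + n)             ∎

^-distribʳ-* : ∀ o m n → (m * n) ^ o ≡ m ^ o * n ^ o
^-distribʳ-* zero    m n = refl
^-distribʳ-* (suc o) m n rewrite ^-distribʳ-* o m n =
  solve 4 (λ m n p q → m :* n :* (p :* q) := m :* p :* (n :* q)) refl m n (m ^ o) (n ^ o)
  where open ℕ-Solver

-- With N = k + 1, this is N (1 - 1/N)^(N²) ≤ N / 2^N ≤ 1/3 after clearing denominators. The N²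
-- samples form N blocks of N, and each block at least halves the chance that a given point stays
-- unseen.
coupon-collector : ∀ k → 4 ℕ.≤ suc k → 3 * (suc k * k ^ (suc k * suc k)) ℕ.≤ suc k ^ (suc k * suc k)
coupon-collector k 4≤N = begin
  3 * (N * k ^ (N * N))    ≡⟨ ℕₚ.*-assoc 3 N _ ⟨
  3 * N * k ^ (N * N)      ≤⟨ ℕₚ.*-monoˡ-≤ _ (3*n≤2^n N 4≤N) ⟩
  2 ^ N * k ^ (N * N)      ≡⟨ cong (2 ^ N *_) (ℕₚ.^-*-assoc k N N) ⟨
  2 ^ N * (k ^ N) ^ N      ≡⟨ ^-distribʳ-* N 2 (k ^ N) ⟨
  (2 * k ^ N) ^ N          ≤⟨ ℕₚ.^-monoˡ-≤ N (half-power k) ⟩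
  (N ^ N) ^ N              ≡⟨ ℕₚ.^-*-assoc N N N ⟩
  N ^ (N * N)              ∎
  where
  open ℕₚ.≤-Reasoning
  N = suc k

-- Comparable pairs among random points

-- q ⊑ x when x agrees with q on the support of q.
extends : Trit → Trit → Bool
extends −1ₜ −1ₜ = true
extends +1ₜ +1ₜ = true
extends 0ₜ  _   = true
extends _   _   = false

_⊑_ : Point n → Point n → Bool
[]      ⊑ []      = true
(s ∷ q) ⊑ (t ∷ x) = extends s t ∧ q ⊑ x

⊑-refl : (x : Point n) → x ⊑ x ≡ true
⊑-refl []        = refl
⊑-refl (−1ₜ ∷ x) = ⊑-refl x
⊑-refl (0ₜ ∷ x)  = ⊑-refl x
⊑-refl (+1ₜ ∷ x) = ⊑-refl x

-- Of the nine pairs of trits five satisfy `extends`: 0 with all three, and each of ±1 with itself.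
-- The coordinates multiply.
∑-⊑ : ∀ n → ∑ (cube n) (λ x → ∑ (cube n) (λ y → 𝟙 (x ⊑ y))) ≡ 5 ^ n
∑-⊑ zero    = refl
∑-⊑ (suc n) = begin
  ∑ (cube (suc n)) (λ x → ∑ (cube (suc n)) (λ y → 𝟙 (x ⊑ y)))
    ≡⟨ ∑-cong (cube (suc n)) (λ x → ∑-cube-suc n (λ y → 𝟙 (x ⊑ y))) ⟩
  ∑ (cube (suc n)) _
    ≡⟨ ∑-cube-suc n _ ⟩
  ∑ (cube n) (λ x → W x + (O + O)) + (∑ (cube n) (λ x → W x + (W x + W x)) + ∑ (cube n) (λ x → O + (O + W x)))
    ≡⟨ cong₂ _+_ (∑-cong (cube n) λ x → cong (λ o → W x + (o + o)) none)
         (cong₂ _+_ (∑-cong (cube n) (λ x → solve 1 (λ w → w :+ (w :+ w) := con 3 :* w) refl (W x)))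
           (∑-cong (cube n) (λ x → cong (λ o → o + (o + W x)) none))) ⟩
  ∑ (cube n) (λ x → W x + 0) + (∑ (cube n) (λ x → 3 * W x) + ∑ (cube n) W)
    ≡⟨ cong₂ _+_ (∑-cong (cube n) (λ x → ℕₚ.+-identityʳ (W x))) (cong (_+ ∑ (cube n) W) (∑-*ˡ (cube n) 3 W)) ⟩
  ∑ (cube n) W + (3 * ∑ (cube n) W + ∑ (cube n) W)
    ≡⟨ solve 1 (λ w → w :+ (con 3 :* w :+ w) := con 5 :* w) refl (∑ (cube n) W) ⟩
  5 * ∑ (cube n) W
    ≡⟨ cong (5 *_) (∑-⊑ n) ⟩
  5 ^ suc n ∎
  where
  open ≡-Reasoning
  open ℕ-Solver
  W : Point n → ℕ
  W x = ∑ (cube n) (λ y → 𝟙 (x ⊑ y))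
  O : ℕ
  O = ∑ (cube n) (λ _ → 0)
  none : O ≡ 0
  none = trans (∑-const (cube n) 0) (ℕₚ.*-zeroʳ (length (cube n)))

-- Both directions are counted, so equal points score 2, and a repeated sample shows up as a
-- comparable pair.
comparable : Point n → Point n → ℕ
comparable x y = 𝟙 (x ⊑ y) + 𝟙 (y ⊑ x)

comparablePairs : Vec (Point n) m → ℕ
comparablePairs []       = 0
comparablePairs (x ∷ xs) = ∑ (toList xs) (comparable x) + comparablePairs xs

∑-comparable : ∀ n → ∑ (cube n) (λ x → ∑ (cube n) (comparable x)) ≡ 2 * 5 ^ n
∑-comparable n = begin
  ∑ (cube n) (λ x → ∑ (cube n) (comparable x))
    ≡⟨ ∑-cong (cube n) (λ x → ∑-+ (cube n) _ _) ⟩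
  ∑ (cube n) (λ x → ∑ (cube n) (λ y → 𝟙 (x ⊑ y)) + ∑ (cube n) (λ y → 𝟙 (y ⊑ x)))
    ≡⟨ ∑-+ (cube n) _ _ ⟩
  ∑ (cube n) (λ x → ∑ (cube n) (λ y → 𝟙 (x ⊑ y))) + ∑ (cube n) (λ x → ∑ (cube n) (λ y → 𝟙 (y ⊑ x)))
    ≡⟨ cong₂ _+_ (∑-⊑ n) (trans (∑-swap (cube n) (cube n) (λ (x y : Point n) → 𝟙 (y ⊑ x))) (∑-⊑ n)) ⟩
  5 ^ n + 5 ^ n
    ≡⟨ cong (5 ^ n +_) (ℕₚ.+-identityʳ (5 ^ n)) ⟨
  2 * 5 ^ n ∎
  where open ≡-Reasoning

-- Both sides carry a factor length as so that no exponent m - 1 occurs.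
∑-tuples-toList : ∀ (as : List A) m (g : A → ℕ) →
  length as * ∑ (tuples as m) (λ xs → ∑ (toList xs) g) ≡ m * (length as ^ m * ∑ as g)
∑-tuples-toList as zero    g = ℕₚ.*-zeroʳ (length as)
∑-tuples-toList as (suc m) g = begin
  N * ∑ (tuples as (suc m)) (λ xs → ∑ (toList xs) g)
    ≡⟨ cong (N *_) (∑-cartesianProductWith _∷_ as (tuples as m) _) ⟩
  N * ∑ as (λ a → ∑ (tuples as m) (λ xs → g a + ∑ (toList xs) g))
    ≡⟨ cong (N *_) (∑-cong as λ a → trans (∑-+ (tuples as m) _ _)
         (cong (_+ F) (trans (∑-const (tuples as m) (g a)) (cong (_* g a) (length-tuples as m))))) ⟩
  N * ∑ as (λ a → N ^ m * g a + F)
    ≡⟨ cong (N *_) (trans (∑-+ as _ _) (cong₂ _+_ (∑-*ˡ as (N ^ m) g) (∑-const as F))) ⟩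
  N * (N ^ m * ∑ as g + N * F)
    ≡⟨ cong (λ k → N * (N ^ m * ∑ as g + k)) (∑-tuples-toList as m g) ⟩
  N * (N ^ m * ∑ as g + m * (N ^ m * ∑ as g))
    ≡⟨ solve 4 (λ N P G m → N :* (P :* G :+ m :* (P :* G)) := (con 1 :+ m) :* ((N :* P) :* G))
         refl N (N ^ m) (∑ as g) m ⟩
  suc m * (N ^ suc m * ∑ as g) ∎
  where
  open ≡-Reasoning
  open ℕ-Solver
  N = length as
  F = ∑ (tuples as m) (λ xs → ∑ (toList xs) g)

-- Each of the m(m-1)/2 pairs of positions has expected score 2 (5/9)^n. Bounding the resulting
-- m(m-1) by m² keeps subtraction out of the induction.
∑-comparablePairs : ∀ n m → (3 ^ n * 3 ^ n) * ∑ (tuples (cube n) m) comparablePairs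
                    ℕ.≤ (m * m) * (5 ^ n * (3 ^ n) ^ m)
∑-comparablePairs n zero    = ℕₚ.≤-reflexive (ℕₚ.*-zeroʳ (3 ^ n * 3 ^ n))
∑-comparablePairs n (suc m) = begin
  N * N * ∑ (tuples (cube n) (suc m)) comparablePairs
    ≡⟨ cong (N * N *_) (∑-cartesianProductWith _∷_ (cube n) (tuples (cube n) m) _) ⟩
  N * N * ∑ (cube n) (λ x → ∑ (tuples (cube n) m) (λ xs → ∑ (toList xs) (comparable x) + comparablePairs xs))
    ≡⟨ cong (N * N *_) (trans (∑-cong (cube n) (λ x → ∑-+ (tuples (cube n) m) _ _))
         (trans (∑-+ (cube n) G _) (cong (∑ (cube n) G +_)
           (trans (∑-const (cube n) P) (cong (_* P) (length-cube n)))))) ⟩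
  N * N * (∑ (cube n) G + N * P)
    ≡⟨ solve 3 (λ N S P → N :* N :* (S :+ N :* P) := N :* (N :* S) :+ N :* (N :* N :* P)) refl N (∑ (cube n) G) P ⟩
  N * (N * ∑ (cube n) G) + N * (N * N * P)
    ≤⟨ ℕₚ.+-mono-≤ (ℕₚ.≤-reflexive (cong (N *_) N*G)) (ℕₚ.*-monoʳ-≤ N (∑-comparablePairs n m)) ⟩
  N * (m * (N ^ m * (2 * 5 ^ n))) + N * (m * m * (5 ^ n * N ^ m))
    -- The added term completes m² + 2m to (m + 1)².
    ≤⟨ ℕₚ.m≤m+n _ (N * (5 ^ n * N ^ m)) ⟩
  N * (m * (N ^ m * (2 * 5 ^ n))) + N * (m * m * (5 ^ n * N ^ m)) + N * (5 ^ n * N ^ m)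
    ≡⟨ solve 4 (λ N m P F → N :* (m :* (P :* (con 2 :* F))) :+ N :* (m :* m :* (F :* P)) :+ N :* (F :* P)
         := ((con 1 :+ m) :* (con 1 :+ m)) :* (F :* (N :* P))) refl N m (N ^ m) (5 ^ n) ⟩
  (suc m * suc m) * (5 ^ n * N ^ suc m) ∎
  where
  open ℕₚ.≤-Reasoning
  open ℕ-Solver
  N = 3 ^ n
  P = ∑ (tuples (cube n) m) comparablePairs
  G : Point n → ℕ
  G x = ∑ (tuples (cube n) m) (λ xs → ∑ (toList xs) (comparable x))
  N*G : N * ∑ (cube n) G ≡ m * (N ^ m * (2 * 5 ^ n))
  N*G = begin-equality
    N * ∑ (cube n) G
      ≡⟨ ∑-*ˡ (cube n) N G ⟨
    ∑ (cube n) (λ x → N * G x)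
      ≡⟨ ∑-cong (cube n) (λ x → subst (λ l → l * G x ≡ m * (l ^ m * ∑ (cube n) (comparable x)))
           (length-cube n) (∑-tuples-toList (cube n) m (comparable x))) ⟩
    ∑ (cube n) (λ x → m * (N ^ m * ∑ (cube n) (comparable x)))
      ≡⟨ trans (∑-*ˡ (cube n) m _) (cong (m *_) (∑-*ˡ (cube n) (N ^ m) _)) ⟩
    m * (N ^ m * ∑ (cube n) (λ x → ∑ (cube n) (comparable x)))
      ≡⟨ cong (λ k → m * (N ^ m * k)) (∑-comparable n) ⟩
    m * (N ^ m * (2 * 5 ^ n)) ∎

-- The square of 729/375 exceeds 27/8, but 729/375 itself does not: this is where the threshold n ≥
-- 2 comes from.
27*375^n≤8*729^n : ∀ n → 2 ℕ.≤ n → 27 * 375 ^ n ℕ.≤ 8 * 729 ^ n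
27*375^n≤8*729^n (suc (suc n)) (s≤s (s≤s _)) = go n
  where
  open ℕₚ.≤-Reasoning
  open ℕ-Solver
  go : ∀ n → 27 * 375 ^ (2 + n) ℕ.≤ 8 * 729 ^ (2 + n)
  go zero    = ℕₚ.m≤m+n 3796875 454653
  go (suc n) = begin
    27 * (375 * 375 ^ (2 + n))
      ≡⟨ solve 1 (λ p → con 27 :* (con 375 :* p) := con 375 :* (con 27 :* p)) refl (375 ^ (2 + n)) ⟩
    375 * (27 * 375 ^ (2 + n))
      ≤⟨ ℕₚ.*-mono-≤ (ℕₚ.m≤m+n 375 354) (go n) ⟩
    729 * (8 * 729 ^ (2 + n))
      ≡⟨ solve 1 (λ p → con 729 :* (con 8 :* p) := con 8 :* (con 729 :* p)) refl (729 ^ (2 + n)) ⟩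
    8 * (729 * 729 ^ (2 + n)) ∎

-- The hypothesis says m² ≥ (2/3) (9/5)^n. Since 9/5 < 3, a power has to be taken; the cube 729/125
-- exceeds 3 by enough to absorb (2/3)³ from n = 2 on. The exponent 6 = 2 · 3 becomes the constant c
-- = 1/6.
3^n≤m^6 : ∀ n m → 2 ℕ.≤ n → 2 * (3 ^ n * 3 ^ n) ℕ.≤ 3 * (m * m * 5 ^ n) → 3 ^ n ℕ.≤ m ^ 6
3^n≤m^6 n m 2≤n le = ℕₚ.*-cancelʳ-≤ (3 ^ n) (m ^ 6) K {{ℕₚ.m*n≢0 27 (125 ^ n) {{_}} {{ℕₚ.m^n≢0 125 n}}}} (begin
  3 ^ n * (27 * 125 ^ n)
    ≡⟨ solve 2 (λ p q → p :* (con 27 :* q) := con 27 :* (p :* q)) refl (3 ^ n) (125 ^ n) ⟩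
  27 * (3 ^ n * 125 ^ n)
    ≡⟨ cong (27 *_) (^-distribʳ-* n 3 125) ⟨
  27 * 375 ^ n
    ≤⟨ 27*375^n≤8*729^n n 2≤n ⟩
  8 * 729 ^ n
    ≡⟨ cong (8 *_) (cube-power 9 n) ⟩
  8 * (9 ^ n) ^ 3
    ≡⟨ cong (λ k → 8 * k ^ 3) (^-distribʳ-* n 3 3) ⟩
  8 * (3 ^ n * 3 ^ n) ^ 3
    ≡⟨ ^-distribʳ-* 3 2 (3 ^ n * 3 ^ n) ⟨
  (2 * (3 ^ n * 3 ^ n)) ^ 3
    ≤⟨ ℕₚ.^-monoˡ-≤ 3 le ⟩
  (3 * (m * m * 5 ^ n)) ^ 3
    ≡⟨ solve 2 (λ m f → (con 3 :* (m :* m :* f)) :^ 3 := m :^ 6 :* (con 27 :* f :^ 3)) refl m (5 ^ n) ⟩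
  m ^ 6 * (27 * (5 ^ n) ^ 3)
    ≡⟨ cong (λ k → m ^ 6 * (27 * k)) (cube-power 5 n) ⟨
  m ^ 6 * (27 * 125 ^ n) ∎)
  where
  open ℕₚ.≤-Reasoning
  open ℕ-Solver
  K = 27 * 125 ^ n
  cube-power : ∀ b n → (b ^ 3) ^ n ≡ (b ^ n) ^ 3
  cube-power b n = trans (ℕₚ.^-*-assoc b 3 n) (trans (cong (b ^_) (ℕₚ.*-comm 3 n)) (sym (ℕₚ.^-*-assoc b n 3)))

-- Rational and real arithmetic

private
  module ℚ-Mult = Algebra.Properties.Semiring.Mult (CommutativeRing.semiring ℚₚ.+-*-commutativeRing)

open ℚ-Mult using (×-homo-+; ×1-homo-*) renaming (_×_ to _×ℚ_)

-- As a multiple of `1ℚ` it inherits the homomorphism laws of semiring multiples, and `ι (suc k)`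
-- unfolds to `1ℚ ℚ.+ ι k`, which later proofs use silently.
ι : ℕ → ℚ
ι k = k ×ℚ 1ℚ

ι-+ : ∀ j k → ι (j + k) ≡ ι j ℚ.+ ι k
ι-+ = ×-homo-+ 1ℚ

ι-* : ∀ j k → ι (j * k) ≡ ι j ℚ.* ι k
ι-* = ×1-homo-*

ι≥0 : ∀ k → 0ℚ ≤ ι k
ι≥0 zero    = ℚₚ.≤-refl
ι≥0 (suc k) = ℚₚ.+-mono-≤ {0ℚ} {1ℚ} (ℚₚ.nonNegative⁻¹ 1ℚ) (ι≥0 k)

ι-suc>0 : ∀ k → 0ℚ < ι (suc k)
ι-suc>0 k = ℚₚ.+-mono-<-≤ {0ℚ} {1ℚ} (ℚₚ.positive⁻¹ 1ℚ) (ι≥0 k)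

ι-pos : ∀ k → .{{ℕ.NonZero k}} → ℚ.Positive (ι k)
ι-pos (suc k) = ℚ.positive (ι-suc>0 k)

ι-mono : ∀ {j k} → j ℕ.≤ k → ι j ≤ ι k
ι-mono {k = k} z≤n = ι≥0 k
ι-mono (s≤s j≤k)   = ℚₚ.+-monoʳ-≤ 1ℚ (ι-mono j≤k)

ι-cancel : ∀ {j k} → ι j ≤ ι k → j ℕ.≤ k
ι-cancel {j} {k} ιj≤ιk with ℕₚ.≤-<-connex j k
... | inj₁ j≤k = j≤k
... | inj₂ k<j = ⊥-elim (ℚₚ.<-irrefl refl (ℚₚ.<-≤-trans ιk<ιj ιj≤ιk))
  where
  ιk<ιj : ι k < ι j
  ιk<ιj = ℚₚ.<-≤-trans
    (subst (_< ι (suc k)) (ℚₚ.+-identityˡ (ι k))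
      (ℚₚ.+-monoˡ-< (ι k) {0ℚ} {1ℚ} (ℚₚ.positive⁻¹ 1ℚ)))
    (ι-mono k<j)

toℚᵘ-ι : ∀ k → toℚᵘ (ι k) ℚᵘ.≃ mkℚᵘ (ℤ.+ k) 0
toℚᵘ-ι zero    = ℚᵘₚ.≃-refl
toℚᵘ-ι (suc k) = ℚᵘₚ.≃-trans (ℚₚ.toℚᵘ-homo-+ 1ℚ (ι k))
  (ℚᵘₚ.≃-trans (ℚᵘₚ.+-congʳ (toℚᵘ 1ℚ) (toℚᵘ-ι k))
    (*≡* (cong (λ i → (ℤ.1ℤ ℤ.+ i) ℤ.* ℤ.1ℤ) (ℤₚ.*-identityʳ (ℤ.+ k)))))

-- `ℚ._/_` divides by a gcd that is stuck on variables. Among unnormalised rationals equality is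
-- cross-multiplication, so the identity is checked there.
/-*-cancel : ∀ k N .{{_ : ℕ.NonZero N}} → (ℤ.+ k ℚ./ N) ℚ.* ι N ≡ ι k
/-*-cancel k N@(suc d) = ℚₚ.toℚᵘ-injective (begin
  toℚᵘ ((ℤ.+ k ℚ./ N) ℚ.* ι N)             ≈⟨ ℚₚ.toℚᵘ-homo-* (ℤ.+ k ℚ./ N) (ι N) ⟩
  toℚᵘ (ℤ.+ k ℚ./ N) ℚᵘ.* toℚᵘ (ι N)       ≈⟨ ℚᵘₚ.*-cong (ℚₚ.toℚᵘ-fromℚᵘ (mkℚᵘ (ℤ.+ k) d)) (toℚᵘ-ι N) ⟩
  mkℚᵘ (ℤ.+ k) d ℚᵘ.* mkℚᵘ (ℤ.+ N) 0         ≈⟨ *≡* (trans (ℤₚ.*-identityʳ _)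
                                              (cong (λ j → ℤ.+ k ℤ.* ℤ.+ j) (sym (ℕₚ.*-identityʳ N)))) ⟩
  mkℚᵘ (ℤ.+ k) 0                            ≈⟨ toℚᵘ-ι k ⟨
  toℚᵘ (ι k)                              ∎)
  where
  open ℚᵘₚ.≃-Reasoning

≤-/⁺ : ∀ {p} k N .{{_ : ℕ.NonZero N}} → p ℚ.* ι N ≤ ι k → p ≤ ℤ.+ k ℚ./ N
≤-/⁺ {p} k N le = ℚₚ.*-cancelʳ-≤-pos (ι N) {{ι-pos N}}
  (subst (p ℚ.* ι N ≤_) (sym (/-*-cancel k N)) le)

0<½* : ∀ {δ} → 0ℚ < δ → 0ℚ < ½ ℚ.* δ
0<½* {δ} 0<δ = subst (_< ½ ℚ.* δ) (ℚₚ.*-zeroʳ ½) (ℚₚ.*-monoʳ-<-pos ½ 0<δ)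

½*+½* : ∀ δ → ½ ℚ.* δ ℚ.+ ½ ℚ.* δ ≡ δ
½*+½* δ = trans (sym (ℚₚ.*-distribʳ-+ δ ½ ½)) (ℚₚ.*-identityˡ δ)

p≤p+q : ∀ p {q} → 0ℚ ≤ q → p ≤ p ℚ.+ q
p≤p+q p {q} 0≤q = subst (_≤ p ℚ.+ q) (ℚₚ.+-identityʳ p) (ℚₚ.+-monoʳ-≤ p 0≤q)

0<q-p : ∀ {p q} → p < q → 0ℚ < q ℚ.- p
0<q-p {p} {q} p<q = subst (_< q ℚ.- p) (ℚₚ.+-inverseʳ p) (ℚₚ.+-monoˡ-< (ℚ.- p) p<q)

p+[q-p]≡q : ∀ p q → p ℚ.+ (q ℚ.- p) ≡ q
p+[q-p]≡q = solve 2 (λ p q → p :+ (q :- p) := q) refl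
  where open ℚ-Solver

-- Applied even to definitionally equal sequences: converting between two reals by
-- definitional equality would compare their Cauchy proofs, which is infeasible.
pointwise-≤ : ∀ x y → (∀ i → seq x i ≤ seq y i) → x ≤ℝ y
pointwise-≤ x y le δ 0<δ = 0 , λ i _ → ℚₚ.≤-trans (le i) (p≤p+q (seq y i) (ℚₚ.<⇒≤ 0<δ))

pointwise-≃ : ∀ x y → (∀ i → seq x i ≡ seq y i) → x ≃ℝ y
pointwise-≃ x y eq =
  pointwise-≤ x y (λ i → ℚₚ.≤-reflexive (eq i)) , pointwise-≤ y x (λ i → ℚₚ.≤-reflexive (sym (eq i)))

≤ℝ-refl : ∀ x → x ≤ℝ x
≤ℝ-refl x = pointwise-≤ x x λ _ → ℚₚ.≤-refl

fromℚ-mono : ∀ {p q} → p ≤ q → fromℚ p ≤ℝ fromℚ q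
fromℚ-mono {p} {q} p≤q = pointwise-≤ (fromℚ p) (fromℚ q) λ _ → p≤q

fromℚ-cancel : ∀ {p q} → fromℚ p ≤ℝ fromℚ q → p ≤ q
fromℚ-cancel {p} {q} le with p ℚₚ.≤? q
... | yes p≤q = p≤q
... | no  p≰q =
  -- `≤ℝ` tolerates any positive error; the error r - q, with r strictly between q and p, is already
  -- too small.
  let r , q<r , r<p = ℚₚ.<-dense (ℚₚ.≰⇒> p≰q)
      N , bound     = le (r ℚ.- q) (0<q-p q<r)
  in ⊥-elim (ℚₚ.<-irrefl refl (ℚₚ.<-≤-trans r<p (subst (p ≤_) (p+[q-p]≡q q r) (bound N ℕₚ.≤-refl))))

≤ℝ-trans : ∀ {x y z} → x ≤ℝ y → y ≤ℝ z → x ≤ℝ z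
≤ℝ-trans {x} {y} {z} x≤y y≤z δ 0<δ = N₁ ℕ.⊔ N₂ , λ i N≤i → begin
    seq x i
      ≤⟨ p₁ i (ℕₚ.m⊔n≤o⇒m≤o N₁ N₂ N≤i) ⟩
    seq y i ℚ.+ ½ ℚ.* δ
      ≤⟨ ℚₚ.+-monoˡ-≤ (½ ℚ.* δ) (p₂ i (ℕₚ.m⊔n≤o⇒n≤o N₁ N₂ N≤i)) ⟩
    seq z i ℚ.+ ½ ℚ.* δ ℚ.+ ½ ℚ.* δ
      ≡⟨ trans (ℚₚ.+-assoc (seq z i) _ _) (cong (seq z i ℚ.+_) (½*+½* δ)) ⟩
    seq z i ℚ.+ δ ∎
  where
  open ℚₚ.≤-Reasoning
  N₁ = proj₁ (x≤y (½ ℚ.* δ) (0<½* 0<δ))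
  N₂ = proj₁ (y≤z (½ ℚ.* δ) (0<½* 0<δ))
  p₁ = proj₂ (x≤y (½ ℚ.* δ) (0<½* 0<δ))
  p₂ = proj₂ (y≤z (½ ℚ.* δ) (0<½* 0<δ))

≃ℝ-trans : ∀ {x y z} → x ≃ℝ y → y ≃ℝ z → x ≃ℝ z
≃ℝ-trans {x} {y} {z} (x≤y , y≤x) (y≤z , z≤y) =
  ≤ℝ-trans {x} {y} {z} x≤y y≤z , ≤ℝ-trans {z} {y} {x} z≤y y≤x

+ℝ-mono : ∀ {x y u v} → x ≤ℝ y → u ≤ℝ v → x +ℝ u ≤ℝ y +ℝ v
+ℝ-mono {x} {y} {u} {v} x≤y u≤v δ 0<δ = N₁ ℕ.⊔ N₂ , λ i N≤i → begin
    seq x i ℚ.+ seq u i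
      ≤⟨ ℚₚ.+-mono-≤ (p₁ i (ℕₚ.m⊔n≤o⇒m≤o N₁ N₂ N≤i)) (p₂ i (ℕₚ.m⊔n≤o⇒n≤o N₁ N₂ N≤i)) ⟩
    seq y i ℚ.+ ½ ℚ.* δ ℚ.+ (seq v i ℚ.+ ½ ℚ.* δ)
      ≡⟨ solve 3 (λ a b h → a :+ h :+ (b :+ h) := a :+ b :+ (h :+ h)) refl (seq y i) (seq v i) (½ ℚ.* δ) ⟩
    seq y i ℚ.+ seq v i ℚ.+ (½ ℚ.* δ ℚ.+ ½ ℚ.* δ)
      ≡⟨ cong (seq y i ℚ.+ seq v i ℚ.+_) (½*+½* δ) ⟩
    seq y i ℚ.+ seq v i ℚ.+ δ ∎
  where
  open ℚₚ.≤-Reasoning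
  open ℚ-Solver
  N₁ = proj₁ (x≤y (½ ℚ.* δ) (0<½* 0<δ))
  N₂ = proj₁ (u≤v (½ ℚ.* δ) (0<½* 0<δ))
  p₁ = proj₂ (x≤y (½ ℚ.* δ) (0<½* 0<δ))
  p₂ = proj₂ (u≤v (½ ℚ.* δ) (0<½* 0<δ))

+ℝ-cancelʳ : ∀ {x y z} → x +ℝ z ≤ℝ y +ℝ z → x ≤ℝ y
+ℝ-cancelʳ {x} {y} {z} le δ 0<δ = N , λ i N≤i →
  subst₂ _≤_ (cancel (seq x i) (seq z i))
    (trans (cong (ℚ._- seq z i) (swap (seq y i) (seq z i))) (cancel (seq y i ℚ.+ δ) (seq z i)))
    (ℚₚ.+-monoˡ-≤ (ℚ.- seq z i) (bound i N≤i))
  where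
  open ℚ-Solver
  N = proj₁ (le δ 0<δ)
  bound = proj₂ (le δ 0<δ)
  cancel : ∀ a c → a ℚ.+ c ℚ.- c ≡ a
  cancel = solve 2 (λ a c → a :+ c :- c := a) refl
  swap : ∀ b c → b ℚ.+ c ℚ.+ δ ≡ b ℚ.+ δ ℚ.+ c
  swap b c = solve 3 (λ b c d → b :+ c :+ d := b :+ d :+ c) refl b c δ

·-monoʳ : ∀ {x y} q → 0ℚ ≤ q → x ≤ℝ y → q · x ≤ℝ q · y
·-monoʳ {x} {y} q 0≤q x≤y δ 0<δ = N , λ i N≤i → begin
    q ℚ.* seq x i
      ≤⟨ ℚₚ.*-monoˡ-≤-nonNeg q (bound i N≤i) ⟩
    q ℚ.* (seq y i ℚ.+ η)
      ≡⟨ ℚₚ.*-distribˡ-+ q (seq y i) η ⟩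
    q ℚ.* seq y i ℚ.+ q ℚ.* η
      ≤⟨ ℚₚ.+-monoʳ-≤ (q ℚ.* seq y i) q*η≤δ ⟩
    q ℚ.* seq y i ℚ.+ δ ∎
  where
  open ℚₚ.≤-Reasoning
  instance
    q⁺ : ℚ.NonNegative q
    q⁺ = ℚ.nonNegative 0≤q
    r⁺ : ℚ.Positive (1ℚ ℚ.+ q)
    r⁺ = ℚₚ.pos+nonNeg⇒pos 1ℚ q
    r≢0 : ℚ.NonZero (1ℚ ℚ.+ q)
    r≢0 = ℚₚ.pos⇒nonZero (1ℚ ℚ.+ q)
    r⁻¹⁺ : ℚ.Positive (ℚ.1/ (1ℚ ℚ.+ q))
    r⁻¹⁺ = ℚₚ.1/pos⇒pos (1ℚ ℚ.+ q)
  η : ℚ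
  -- Dividing by 1 + q instead of q covers q = 0 as well.
  η = ℚ.1/ (1ℚ ℚ.+ q) ℚ.* δ
  0<η : 0ℚ < η
  0<η = subst (_< η) (ℚₚ.*-zeroʳ (ℚ.1/ (1ℚ ℚ.+ q))) (ℚₚ.*-monoʳ-<-pos (ℚ.1/ (1ℚ ℚ.+ q)) 0<δ)
  q*η≤δ : q ℚ.* η ≤ δ
  q*η≤δ = begin
    q ℚ.* η
      ≤⟨ ℚₚ.*-monoʳ-≤-nonNeg η {{ℚ.nonNegative (ℚₚ.<⇒≤ 0<η)}}
           (subst (_≤ 1ℚ ℚ.+ q) (ℚₚ.+-identityˡ q) (ℚₚ.+-monoˡ-≤ q {0ℚ} {1ℚ} (ℚₚ.nonNegative⁻¹ 1ℚ))) ⟩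
    (1ℚ ℚ.+ q) ℚ.* η
      ≡⟨ ℚₚ.*-assoc (1ℚ ℚ.+ q) _ δ ⟨
    (1ℚ ℚ.+ q) ℚ.* ℚ.1/ (1ℚ ℚ.+ q) ℚ.* δ
      ≡⟨ cong (ℚ._* δ) (ℚₚ.*-inverseʳ (1ℚ ℚ.+ q)) ⟩
    1ℚ ℚ.* δ
      ≡⟨ ℚₚ.*-identityˡ δ ⟩
    δ ∎
  N = proj₁ (x≤y η 0<η)
  bound = proj₂ (x≤y η 0<η)

-- q x is p x + (q - p) x, and `·-monoʳ` with the factor q - p bounds the second summand below.
·-monoˡ : ∀ {x p q} → 0ℝ ≤ℝ x → p ≤ q → p · x ≤ℝ q · x
·-monoˡ {x} {p} {q} 0≤x p≤q δ 0<δ = N , λ i N≤i → begin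
    p ℚ.* seq x i
      ≡⟨ ℚₚ.+-identityʳ (p ℚ.* seq x i) ⟨
    p ℚ.* seq x i ℚ.+ 0ℚ
      ≡⟨ cong (p ℚ.* seq x i ℚ.+_) (ℚₚ.*-zeroʳ (q ℚ.- p)) ⟨
    p ℚ.* seq x i ℚ.+ (q ℚ.- p) ℚ.* 0ℚ
      ≤⟨ ℚₚ.+-monoʳ-≤ (p ℚ.* seq x i) (bound i N≤i) ⟩
    p ℚ.* seq x i ℚ.+ ((q ℚ.- p) ℚ.* seq x i ℚ.+ δ)
      ≡⟨ solve 4 (λ p q x d → p :* x :+ ((q :- p) :* x :+ d) := q :* x :+ d) refl p q (seq x i) δ ⟩
    q ℚ.* seq x i ℚ.+ δ ∎
  where
  open ℚₚ.≤-Reasoning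
  open ℚ-Solver
  0≤q-p : 0ℚ ≤ q ℚ.- p
  0≤q-p = subst (_≤ q ℚ.- p) (ℚₚ.+-inverseʳ p) (ℚₚ.+-monoˡ-≤ (ℚ.- p) p≤q)
  scaled = ·-monoʳ {0ℝ} {x} (q ℚ.- p) 0≤q-p 0≤x δ 0<δ
  N = proj₁ scaled
  bound = proj₂ scaled

-- Monotonicity holds for the factor -q; adding q x + q y to both sides gives the claim.
·-antiʳ : ∀ {x y} q → q ≤ 0ℚ → x ≤ℝ y → q · y ≤ℝ q · x
·-antiʳ {x} {y} q q≤0 x≤y δ 0<δ = N , λ i N≤i →
  subst₂ _≤_ (lhs (seq x i) (seq y i)) (rhs (seq x i) (seq y i))
    (ℚₚ.+-monoʳ-≤ (q ℚ.* seq x i ℚ.+ q ℚ.* seq y i) (bound i N≤i))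
  where
  open ℚ-Solver
  scaled = ·-monoʳ {x} {y} (ℚ.- q) (ℚₚ.neg-antimono-≤ q≤0) x≤y δ 0<δ
  N = proj₁ scaled
  bound = proj₂ scaled
  lhs : ∀ a b → q ℚ.* a ℚ.+ q ℚ.* b ℚ.+ (ℚ.- q) ℚ.* a ≡ q ℚ.* b
  lhs a b = solve 3 (λ q a b → q :* a :+ q :* b :+ (:- q) :* a := q :* b) refl q a b
  rhs : ∀ a b → q ℚ.* a ℚ.+ q ℚ.* b ℚ.+ ((ℚ.- q) ℚ.* b ℚ.+ δ) ≡ q ℚ.* a ℚ.+ δ
  rhs a b = solve 4 (λ q a b d → q :* a :+ q :* b :+ ((:- q) :* b :+ d) := q :* a :+ d) refl q a b δ

·-cong : ∀ {x y} q → x ≃ℝ y → q · x ≃ℝ q · y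
·-cong {x} {y} q (x≤y , y≤x) with ℚₚ.≤-total 0ℚ q
... | inj₁ 0≤q = ·-monoʳ {x} {y} q 0≤q x≤y , ·-monoʳ {y} {x} q 0≤q y≤x
... | inj₂ q≤0 = ·-antiʳ {y} {x} q q≤0 y≤x , ·-antiʳ {x} {y} q q≤0 x≤y

Σℚ : (A → ℚ) → List A → ℚ
Σℚ f = foldr (λ a s → f a ℚ.+ s) 0ℚ

-- Reduces identities between real sums to identities between rational sums, index by index.
seq-Σℝ : ∀ (f : A → ℝ) as i → seq (Σℝ f as) i ≡ Σℚ (λ a → seq (f a) i) as
seq-Σℝ f []       i = refl
seq-Σℝ f (a ∷ as) i = cong (seq (f a) i ℚ.+_) (seq-Σℝ f as i)

Σℚ-ι : ∀ (f : A → ℕ) as → Σℚ (ι ∘ f) as ≡ ι (∑ as f)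
Σℚ-ι f []       = refl
Σℚ-ι f (a ∷ as) = trans (cong (ι (f a) ℚ.+_) (Σℚ-ι f as)) (sym (ι-+ (f a) (∑ as f)))

Σℚ-cong : ∀ {f g : A → ℚ} → (∀ a → f a ≡ g a) → ∀ as → Σℚ f as ≡ Σℚ g as
Σℚ-cong eq []       = refl
Σℚ-cong eq (a ∷ as) = cong₂ ℚ._+_ (eq a) (Σℚ-cong eq as)

Σℚ-mono : ∀ {f g : A → ℚ} → (∀ a → f a ≤ g a) → ∀ as → Σℚ f as ≤ Σℚ g as
Σℚ-mono le []       = ℚₚ.≤-refl
Σℚ-mono le (a ∷ as) = ℚₚ.+-mono-≤ (le a) (Σℚ-mono le as)

Σℚ-+ : ∀ (f g : A → ℚ) as → Σℚ (λ a → f a ℚ.+ g a) as ≡ Σℚ f as ℚ.+ Σℚ g as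
Σℚ-+ f g []       = refl
Σℚ-+ f g (a ∷ as) rewrite Σℚ-+ f g as =
  solve 4 (λ w x y z → (w :+ x) :+ (y :+ z) := (w :+ y) :+ (x :+ z)) refl
    (f a) (g a) (Σℚ f as) (Σℚ g as)
  where open ℚ-Solver

Σℚ-* : ∀ c (f : A → ℚ) as → Σℚ (λ a → c ℚ.* f a) as ≡ c ℚ.* Σℚ f as
Σℚ-* c f []       = sym (ℚₚ.*-zeroʳ c)
Σℚ-* c f (a ∷ as) = trans (cong (c ℚ.* f a ℚ.+_) (Σℚ-* c f as)) (sym (ℚₚ.*-distribˡ-+ c (f a) (Σℚ f as)))

Σℚ-++ : ∀ (f : A → ℚ) as bs → Σℚ f (as ++ bs) ≡ Σℚ f as ℚ.+ Σℚ f bs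
Σℚ-++ f []       bs = sym (ℚₚ.+-identityˡ (Σℚ f bs))
Σℚ-++ f (a ∷ as) bs = trans (cong (f a ℚ.+_) (Σℚ-++ f as bs)) (sym (ℚₚ.+-assoc (f a) (Σℚ f as) (Σℚ f bs)))

Σℚ-map : ∀ (f : B → ℚ) (g : A → B) as → Σℚ f (map g as) ≡ Σℚ (f ∘ g) as
Σℚ-map f g []       = refl
Σℚ-map f g (a ∷ as) = cong (f (g a) ℚ.+_) (Σℚ-map f g as)

Σℝ-mono : ∀ {f g : A → ℝ} {as} → (∀ {a} → a ∈ as → f a ≤ℝ g a) → Σℝ f as ≤ℝ Σℝ g as
Σℝ-mono {as = []} le = ≤ℝ-refl 0ℝ
Σℝ-mono {f = f} {g} {a ∷ as} le =
  +ℝ-mono {f a} {g a} {Σℝ f as} {Σℝ g as} (le (here refl)) (Σℝ-mono {f = f} {g} {as} (le ∘ there))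

Σℝ-fromℚ : ∀ (f : A → ℚ) as → Σℝ (λ a → fromℚ (f a)) as ≃ℝ fromℚ (Σℚ f as)
Σℝ-fromℚ {A} f as = pointwise-≃ (Σℝ (λ a → fromℚ (f a)) as) (fromℚ (Σℚ f as)) (seq-Σℝ {A} (λ a → fromℚ (f a)) as)

Σℝ-· : ∀ c (f : A → ℝ) as → Σℝ (λ a → c · f a) as ≃ℝ c · Σℝ f as
Σℝ-· c f as = pointwise-≃ (Σℝ (λ a → c · f a) as) (c · Σℝ f as) λ i →
  trans (seq-Σℝ (λ a → c · f a) as i)
    (trans (Σℚ-* c (λ a → seq (f a) i) as) (cong (c ℚ.*_) (sym (seq-Σℝ f as i))))

-- Convex hulls and separation

rational∈Conv : ∀ (S : Subset n) x (ws : List (ℚ × Point n)) →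
  All (λ (w , y) → 0ℚ ≤ w × S y ≡ true) ws →
  Σℚ proj₁ ws ≡ 1ℚ →
  (∀ i → Σℚ (λ (w , y) → toℚ (lookup y i) ℚ.* w) ws ≡ toℚ (lookup x i)) →
  embed x ∈Conv S
rational∈Conv {n} S x ws ok total moment =
  map real ws ,
  Allₚ.map⁺ (All.map (λ {(w , y)} (0≤w , y∈S) → fromℚ-mono {0ℚ} {w} 0≤w , y∈S) ok) ,
  pointwise-≃ (Σℝ proj₁ (map real ws)) 1ℝ
    (λ k → trans (seq-Σℝ proj₁ (map real ws) k)
             (trans (Σℚ-map (λ (w , y) → seq w k) real ws) total)) ,
  (λ i → subst (Σℝ (λ (w , y) → toℚ (lookup y i) · w) (map real ws) ≃ℝ_)
           (sym (Vecₚ.lookup-map i (λ t → fromℚ (toℚ t)) x))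
           (pointwise-≃ (Σℝ (λ (w , y) → toℚ (lookup y i) · w) (map real ws)) (fromℚ (toℚ (lookup x i)))
             (λ k → trans (seq-Σℝ (λ (w , y) → toℚ (lookup y i) · w) (map real ws) k)
               (trans (Σℚ-map (λ (w , y) → toℚ (lookup y i) ℚ.* seq w k) real ws) (moment i)))))
  where
  real : ℚ × Point n → ℝ × Point n
  real (w , y) = fromℚ w , y

⊆Conv : ∀ (S : Subset n) x → S x ≡ true → embed x ∈Conv S
⊆Conv S x x∈S = rational∈Conv S x ((1ℚ , x) ∷ []) ((ℚₚ.nonNegative⁻¹ 1ℚ , x∈S) ∷ []) refl
  (λ i → trans (ℚₚ.+-identityʳ _) (ℚₚ.*-identityʳ _))

midpoint∈Conv : ∀ (S : Subset (suc n)) y → S (−1ₜ ∷ y) ≡ true → S (+1ₜ ∷ y) ≡ true →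
                embed (0ₜ ∷ y) ∈Conv S
midpoint∈Conv S y −y∈S +y∈S = rational∈Conv S (0ₜ ∷ y) ((½ , −1ₜ ∷ y) ∷ (½ , +1ₜ ∷ y) ∷ [])
  ((ℚₚ.nonNegative⁻¹ ½ , −y∈S) ∷ (ℚₚ.nonNegative⁻¹ ½ , +y∈S) ∷ []) refl
  λ where
    zero    → refl
    (suc i) → halves (lookup y i)
  where
  halves : ∀ t → toℚ t ℚ.* ½ ℚ.+ (toℚ t ℚ.* ½ ℚ.+ 0ℚ) ≡ toℚ t
  halves −1ₜ = refl
  halves 0ₜ  = refl
  halves +1ₜ = refl

-- Taken on functions so that `coords x` of a point and `lookup u` of a vector are both arguments.
dot : ∀ {d} → (Fin d → ℚ) → (Fin d → ℚ) → ℚ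
dot {zero}  u v = 0ℚ
dot {suc d} u v = u zero ℚ.* v zero ℚ.+ dot (u ∘ suc) (v ∘ suc)

coords : Point n → Fin n → ℚ
coords x i = toℚ (lookup x i)

lookup-embed : ∀ (x : Point n) i → lookup (embed x) i ≡ fromℚ (coords x i)
lookup-embed (t ∷ x) zero    = refl
lookup-embed (t ∷ x) (suc i) = lookup-embed x i

-- Linearity of `dot u`: the coordinatewise equations of a hull combination fix the weighted mean of
-- every rational functional.
Σℝ-dot : ∀ {d} (u : Fin d → ℚ) (as : List A) (w : A → ℝ) (v : A → Fin d → ℚ) v₀ →
  (∀ i → Σℝ (λ a → v a i · w a) as ≃ℝ fromℚ (v₀ i)) →
  Σℝ (λ a → dot u (v a) · w a) as ≃ℝ fromℚ (dot u v₀)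
Σℝ-dot {d = zero} u as w v v₀ eq = pointwise-≃ (Σℝ (λ a → dot u (v a) · w a) as) (fromℚ (dot u v₀)) λ k →
  trans (seq-Σℝ (λ a → dot u (v a) · w a) as k)
    (trans (Σℚ-* 0ℚ (λ a → seq (w a) k) as) (ℚₚ.*-zeroˡ (Σℚ (λ a → seq (w a) k) as)))
Σℝ-dot {A} {suc d} u as w v v₀ eq =
  ≃ℝ-trans {lhs} {u zero · first +ℝ rest} {fromℚ (dot u v₀)}
    (pointwise-≃ lhs (u zero · first +ℝ rest) λ k → begin
      seq lhs k
        ≡⟨ seq-Σℝ (λ a → dot u (v a) · w a) as k ⟩
      Σℚ (λ a → dot u (v a) ℚ.* seq (w a) k) as
        ≡⟨ Σℚ-cong (λ a → solve 4 (λ c x s w → (c :* x :+ s) :* w := c :* (x :* w) :+ s :* w) refl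
             (u zero) (v a zero) (dot (u ∘ suc) (v a ∘ suc)) (seq (w a) k)) as ⟩
      Σℚ (λ a → u zero ℚ.* (v a zero ℚ.* seq (w a) k) ℚ.+ dot (u ∘ suc) (v a ∘ suc) ℚ.* seq (w a) k) as
        ≡⟨ Σℚ-+ (λ a → u zero ℚ.* (v a zero ℚ.* seq (w a) k))
             (λ a → dot (u ∘ suc) (v a ∘ suc) ℚ.* seq (w a) k) as ⟩
      Σℚ (λ a → u zero ℚ.* (v a zero ℚ.* seq (w a) k)) as
        ℚ.+ Σℚ (λ a → dot (u ∘ suc) (v a ∘ suc) ℚ.* seq (w a) k) as
        ≡⟨ cong (ℚ._+ Σℚ (λ a → dot (u ∘ suc) (v a ∘ suc) ℚ.* seq (w a) k) as)
             (Σℚ-* (u zero) (λ a → v a zero ℚ.* seq (w a) k) as) ⟩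
      u zero ℚ.* Σℚ (λ a → v a zero ℚ.* seq (w a) k) as
        ℚ.+ Σℚ (λ a → dot (u ∘ suc) (v a ∘ suc) ℚ.* seq (w a) k) as
        ≡⟨ cong₂ (λ p q → u zero ℚ.* p ℚ.+ q) (seq-Σℝ (λ a → v a zero · w a) as k)
             (seq-Σℝ (λ a → dot (u ∘ suc) (v a ∘ suc) · w a) as k) ⟨
      u zero ℚ.* seq first k ℚ.+ seq rest k ∎)
    (≃ℝ-trans {u zero · first +ℝ rest} {rhs} {fromℚ (dot u v₀)}
      ( +ℝ-mono {u zero · first} {u zero · fromℚ (v₀ zero)}
          {rest} {fromℚ (dot (u ∘ suc) (v₀ ∘ suc))} (proj₁ eq₀) (proj₁ eqₛ)
      , +ℝ-mono {u zero · fromℚ (v₀ zero)} {u zero · first}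
          {fromℚ (dot (u ∘ suc) (v₀ ∘ suc))} {rest} (proj₂ eq₀) (proj₂ eqₛ))
      (pointwise-≃ rhs (fromℚ (dot u v₀)) λ _ → refl))
  where
  open ≡-Reasoning
  open ℚ-Solver
  lhs first rest rhs : ℝ
  lhs   = Σℝ (λ a → dot u (v a) · w a) as
  first = Σℝ (λ a → v a zero · w a) as
  rest  = Σℝ (λ a → dot (u ∘ suc) (v a ∘ suc) · w a) as
  rhs   = u zero · fromℚ (v₀ zero) +ℝ fromℚ (dot (u ∘ suc) (v₀ ∘ suc))
  eq₀ : u zero · first ≃ℝ u zero · fromℚ (v₀ zero)
  eq₀ = ·-cong {first} {fromℚ (v₀ zero)} (u zero) (eq zero)
  eqₛ : rest ≃ℝ fromℚ (dot (u ∘ suc) (v₀ ∘ suc))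
  eqₛ = Σℝ-dot (u ∘ suc) as w (λ a → v a ∘ suc) (v₀ ∘ suc) (eq ∘ suc)

<-below : ∀ qs → ∃[ m ] All (m <_) qs
<-below []       = 0ℚ , []
<-below (q ∷ qs) with m , m<qs ← <-below qs with m ℚₚ.<? q
... | yes m<q = m , m<q ∷ m<qs
... | no  m≮q = q ℚ.- 1ℚ , q-1<q ∷ All.map (ℚₚ.<-trans (ℚₚ.<-≤-trans q-1<q (ℚₚ.≮⇒≥ m≮q))) m<qs
  where
  q-1<q : q ℚ.- 1ℚ < q
  q-1<q = subst (q ℚ.- 1ℚ <_) (ℚₚ.+-identityʳ q) (ℚₚ.+-monoʳ-< q (ℚₚ.negative⁻¹ (ℚ.- 1ℚ)))

-- Finiteness turns separate strict inequalities into one common gap, by density of ℚ.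
<-above : ∀ p {qs} → All (p <_) qs → ∃[ m ] (p < m × All (m <_) qs)
<-above p {[]}     []           = p ℚ.+ 1ℚ ,
  subst (_< p ℚ.+ 1ℚ) (ℚₚ.+-identityʳ p) (ℚₚ.+-monoʳ-< p (ℚₚ.positive⁻¹ 1ℚ)) , []
<-above p {q ∷ qs} (p<q ∷ p<qs) with m , p<m , m<qs ← <-above p p<qs with m ℚₚ.<? q
... | yes m<q = m , p<m , m<q ∷ m<qs
... | no  m≮q with r , p<r , r<q ← ℚₚ.<-dense p<q =
  r , p<r , r<q ∷ All.map (ℚₚ.<-trans (ℚₚ.<-≤-trans r<q (ℚₚ.≮⇒≥ m≮q))) m<qs

-- Solves for the coordinate removed by an elimination step: `ps` are its lower bounds and `qs` its
-- upper bounds.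
<-between : ∀ ps qs → All (λ p → All (p <_) qs) ps → ∃[ m ] (All (_< m) ps × All (m <_) qs)
<-between []       qs []            with m , m<qs ← <-below qs = m , [] , m<qs
<-between (p ∷ ps) qs (p<qs ∷ ps<qs) with m , ps<m , m<qs ← <-between ps qs ps<qs with p ℚₚ.<? m
... | yes p<m = m , p<m ∷ ps<m , m<qs
... | no  p≮m with r , p<r , r<qs ← <-above p p<qs =
  r , p<r ∷ All.map (λ q<m → ℚₚ.<-trans q<m (ℚₚ.≤-<-trans (ℚₚ.≮⇒≥ p≮m) p<r)) ps<m , r<qs

-- Which real weights are positive is undecidable, so strictness cannot be read off the weighted
-- sum. A rational μ strictly between the value at x and the values at the points used carries it
-- instead: μ = Σ w μ ≤ Σ w (u · y) = u · x < μ.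
separated⇒∉Conv : ∀ {S : Subset n} {x} (u : Fin n → ℚ) →
  (∀ y → S y ≡ true → dot u (coords x) < dot u (coords y)) → ¬ (embed x ∈Conv S)
separated⇒∉Conv {n} {S} {x} u sep (ws , ok , total , moment) =
  ℚₚ.<-irrefl refl (ℚₚ.<-≤-trans φx<μ
    (subst (_≤ dot u (coords x)) (ℚₚ.*-identityʳ μ) (fromℚ-cancel {μ ℚ.* 1ℚ} {dot u (coords x)} μ≤φx)))
  where
  gap : ∃[ μ ] (dot u (coords x) < μ × All (μ <_) (map (λ a → dot u (coords (proj₂ a))) ws))
  gap = <-above (dot u (coords x)) (Allₚ.map⁺ (All.map (λ {(w , y)} (_ , y∈S) → sep y y∈S) ok))
  μ : ℚ
  μ = proj₁ gap
  φx<μ : dot u (coords x) < μ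
  φx<μ = proj₁ (proj₂ gap)
  Σμ Σφ : ℝ
  Σμ = Σℝ (λ a → μ · proj₁ a) ws
  Σφ = Σℝ (λ a → dot u (coords (proj₂ a)) · proj₁ a) ws
  Σμ≤Σφ : Σμ ≤ℝ Σφ
  Σμ≤Σφ = Σℝ-mono {f = λ a → μ · proj₁ a} {λ a → dot u (coords (proj₂ a)) · proj₁ a} {ws} λ {a} a∈ws →
    ·-monoˡ {proj₁ a} {μ} {dot u (coords (proj₂ a))} (proj₁ (All.lookup ok a∈ws))
      (ℚₚ.<⇒≤ (All.lookup (Allₚ.map⁻ (proj₂ (proj₂ gap))) a∈ws))
  moments : ∀ i → Σℝ (λ a → coords (proj₂ a) i · proj₁ a) ws ≃ℝ fromℚ (coords x i)
  moments i = ≃ℝ-trans {Σℝ (λ a → coords (proj₂ a) i · proj₁ a) ws}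
    {Σℝ (λ a → toℚ (lookup (proj₂ a) i) · proj₁ a) ws} {fromℚ (coords x i)}
    (pointwise-≃ (Σℝ (λ a → coords (proj₂ a) i · proj₁ a) ws) (Σℝ (λ a → toℚ (lookup (proj₂ a) i) · proj₁ a) ws)
      λ k → trans (seq-Σℝ (λ a → coords (proj₂ a) i · proj₁ a) ws k)
        (sym (seq-Σℝ (λ a → toℚ (lookup (proj₂ a) i) · proj₁ a) ws k)))
    (subst (λ y → Σℝ (λ a → toℚ (lookup (proj₂ a) i) · proj₁ a) ws ≃ℝ y) (lookup-embed x i) (moment i))
  Σφ≃φx : Σφ ≃ℝ fromℚ (dot u (coords x))
  Σφ≃φx = Σℝ-dot u ws proj₁ (λ a → coords (proj₂ a)) (coords x) moments
  μ≤φx : fromℚ (μ ℚ.* 1ℚ) ≤ℝ fromℚ (dot u (coords x))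
  μ≤φx = ≤ℝ-trans {fromℚ (μ ℚ.* 1ℚ)} {μ · 1ℝ} {fromℚ (dot u (coords x))}
    (pointwise-≤ (fromℚ (μ ℚ.* 1ℚ)) (μ · 1ℝ) λ _ → ℚₚ.≤-refl)
    (≤ℝ-trans {μ · 1ℝ} {μ · Σℝ proj₁ ws} {fromℚ (dot u (coords x))}
      (proj₂ (·-cong {Σℝ proj₁ ws} {1ℝ} μ total))
      (≤ℝ-trans {μ · Σℝ proj₁ ws} {Σμ} {fromℚ (dot u (coords x))}
        (proj₂ (Σℝ-· μ proj₁ ws))
        (≤ℝ-trans {Σμ} {Σφ} {fromℚ (dot u (coords x))} Σμ≤Σφ (proj₁ Σφ≃φx))))

convex : ∀ {S : Subset n} → (∀ x → S x ≡ false → ¬ (embed x ∈Conv S)) → Convex S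
convex {S = S} ∉Conv x = mk⇔ (⊆Conv S x) (from (S x) refl)
  where
  from : ∀ b → S x ≡ b → embed x ∈Conv S → S x ≡ true
  from true  x∈S _      = x∈S
  from false x∉S x∈Conv = ⊥-elim (∉Conv x x∉S x∈Conv)

-- Gordan's alternative over ℚ

-- Elimination only adds vectors and scales them positively. Carrying membership in an abstract `Q`
-- through it certifies the derived vectors without tracking coefficients.
record IsCone {d} (Q : Vec ℚ d → Set) : Set where
  field
    add   : ∀ {u v} → Q u → Q v → Q (Vec.zipWith ℚ._+_ u v)
    scale : ∀ {c v} → 0ℚ < c → Q v → Q (Vec.map (c ℚ.*_) v)

_∙_ : Vec ℚ d → Vec ℚ d → ℚ
u ∙ v = dot (lookup u) (lookup v)

∙-+ : ∀ (y u v : Vec ℚ d) → y ∙ Vec.zipWith ℚ._+_ u v ≡ y ∙ u ℚ.+ y ∙ v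
∙-+ []      []      []      = refl
∙-+ (c ∷ y) (a ∷ u) (b ∷ v) = trans (cong (c ℚ.* (a ℚ.+ b) ℚ.+_) (∙-+ y u v))
  (solve 5 (λ c a b s t → c :* (a :+ b) :+ (s :+ t) := c :* a :+ s :+ (c :* b :+ t)) refl c a b (y ∙ u) (y ∙ v))
  where open ℚ-Solver

∙-* : ∀ c (y v : Vec ℚ d) → y ∙ Vec.map (c ℚ.*_) v ≡ c ℚ.* (y ∙ v)
∙-* c []      []      = sym (ℚₚ.*-zeroʳ c)
∙-* c (b ∷ y) (a ∷ v) = trans (cong (b ℚ.* (c ℚ.* a) ℚ.+_) (∙-* c y v))
  (solve 4 (λ c b a s → b :* (c :* a) :+ c :* s := c :* (b :* a :+ s)) refl c b a (y ∙ v))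
  where open ℚ-Solver

-- A list of vectors split by the sign of the first coordinate, which is then
-- scaled to 1 or −1 where it is nonzero.
record Split {d} (Q : Vec ℚ (suc d) → Set) (vs : List (Vec ℚ (suc d))) : Set where
  field
    pos zer neg : List (Vec ℚ d)
    pos∈ : All (λ v → Q (1ℚ ∷ v)) pos
    zer∈ : All (λ v → Q (0ℚ ∷ v)) zer
    neg∈ : All (λ v → Q (ℚ.- 1ℚ ∷ v)) neg
    solves : ∀ c y → All (λ v → 0ℚ < c ℚ.+ y ∙ v) pos → All (λ v → 0ℚ < y ∙ v) zer →
             All (λ v → c < y ∙ v) neg → All (λ v → 0ℚ < (c ∷ y) ∙ v) vs

-- Scaling by 1/|a| does not change the sign of an inner product, and `scale` keeps the vector in
-- `Q`.
split : ∀ {d} {Q : Vec ℚ (suc d) → Set} → IsCone Q → ∀ vs → All Q vs → Split Q vs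
split cone []             []         = record
  { pos∈ = [] ; zer∈ = [] ; neg∈ = [] ; solves = λ _ _ _ _ _ → [] }
split {Q = Q} cone ((a ∷ v) ∷ vs) (q ∷ qs) with split cone vs qs | ℚₚ.<-cmp 0ℚ a
... | s | tri≈ _ refl _ = record
  { pos∈ = pos∈ ; zer∈ = q ∷ zer∈ ; neg∈ = neg∈
  ; solves = λ { c y ps (z ∷ zs) ns →
      subst (0ℚ <_) (sym (trans (cong (ℚ._+ y ∙ v) (ℚₚ.*-zeroʳ c)) (ℚₚ.+-identityˡ (y ∙ v)))) z
        ∷ solves c y ps zs ns } }
  where open Split s
... | s | tri< 0<a _ _ = record
  { pos∈ = subst (λ b → Q (b ∷ v′)) (ℚₚ.*-inverseˡ a) (IsCone.scale cone (ℚₚ.positive⁻¹ r {{r⁺}}) q) ∷ pos∈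
  ; zer∈ = zer∈ ; neg∈ = neg∈
  ; solves = λ { c y (p ∷ ps) zs ns →
      subst₂ _<_ (ℚₚ.*-zeroʳ a) (unscale c (y ∙ v))
        (ℚₚ.*-monoʳ-<-pos a (subst (λ e → 0ℚ < c ℚ.+ e) (∙-* r y v) p)) ∷ solves c y ps zs ns } }
  where
  open Split s
  open ≡-Reasoning
  open ℚ-Solver
  instance
    a⁺ : ℚ.Positive a
    a⁺ = ℚ.positive 0<a
    a≢0 : ℚ.NonZero a
    a≢0 = ℚₚ.pos⇒nonZero a
  r : ℚ
  r = ℚ.1/ a
  r⁺ : ℚ.Positive r
  r⁺ = ℚₚ.1/pos⇒pos a
  v′ = Vec.map (r ℚ.*_) v
  unscale : ∀ c e → a ℚ.* (c ℚ.+ r ℚ.* e) ≡ c ℚ.* a ℚ.+ e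
  unscale c e = begin
    a ℚ.* (c ℚ.+ r ℚ.* e)          ≡⟨ solve 4 (λ a c r e → a :* (c :+ r :* e) := c :* a :+ (a :* r) :* e) refl a c r e ⟩
    c ℚ.* a ℚ.+ (a ℚ.* r) ℚ.* e    ≡⟨ cong (λ k → c ℚ.* a ℚ.+ k ℚ.* e) (ℚₚ.*-inverseʳ a) ⟩
    c ℚ.* a ℚ.+ 1ℚ ℚ.* e           ≡⟨ cong (c ℚ.* a ℚ.+_) (ℚₚ.*-identityˡ e) ⟩
    c ℚ.* a ℚ.+ e                  ∎
... | s | tri> _ _ a<0 = record
  { pos∈ = pos∈ ; zer∈ = zer∈
  ; neg∈ = subst (λ b → Q (b ∷ v′))
             (trans (solve 2 (λ r a → r :* a := :- (r :* (:- a))) refl r a) (cong ℚ.-_ (ℚₚ.*-inverseˡ (ℚ.- a))))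
             (IsCone.scale cone (ℚₚ.positive⁻¹ r {{r⁺}}) q) ∷ neg∈
  ; solves = λ { c y ps zs (p ∷ ns) →
      subst₂ _<_ (ℚₚ.*-zeroʳ (ℚ.- a)) (unscale c (y ∙ v))
        (ℚₚ.*-monoʳ-<-pos (ℚ.- a) (0<q-p (subst (c <_) (∙-* r y v) p))) ∷ solves c y ps zs ns } }
  where
  open Split s
  open ≡-Reasoning
  open ℚ-Solver
  instance
    a⁺ : ℚ.Positive (ℚ.- a)
    a⁺ = ℚ.positive (ℚₚ.neg-antimono-< a<0)
    a≢0 : ℚ.NonZero (ℚ.- a)
    a≢0 = ℚₚ.pos⇒nonZero (ℚ.- a)
  r : ℚ
  r = ℚ.1/ (ℚ.- a)
  r⁺ : ℚ.Positive r
  r⁺ = ℚₚ.1/pos⇒pos (ℚ.- a)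
  v′ = Vec.map (r ℚ.*_) v
  unscale : ∀ c e → (ℚ.- a) ℚ.* (r ℚ.* e ℚ.- c) ≡ c ℚ.* a ℚ.+ e
  unscale c e = begin
    (ℚ.- a) ℚ.* (r ℚ.* e ℚ.- c)
      ≡⟨ solve 4 (λ a c r e → (:- a) :* (r :* e :- c) := c :* a :+ ((:- a) :* r) :* e) refl a c r e ⟩
    c ℚ.* a ℚ.+ ((ℚ.- a) ℚ.* r) ℚ.* e      ≡⟨ cong (λ k → c ℚ.* a ℚ.+ k ℚ.* e) (ℚₚ.*-inverseʳ (ℚ.- a)) ⟩
    c ℚ.* a ℚ.+ 1ℚ ℚ.* e                   ≡⟨ cong (c ℚ.* a ℚ.+_) (ℚₚ.*-identityˡ e) ⟩
    c ℚ.* a ℚ.+ e                          ∎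

-- Gordan's alternative, by Fourier–Motzkin elimination of the first coordinate.
gordan : ∀ {d} {Q : Vec ℚ d → Set} → IsCone Q → ∀ vs → All Q vs →
         (∃[ y ] All (λ v → 0ℚ < y ∙ v) vs) ⊎ Q (Vec.replicate d 0ℚ)
gordan {zero}  cone []        []      = inj₁ ([] , [])
-- In dimension zero every vector is the zero vector, so any member of the list is the certificate.
gordan {zero}  cone ([] ∷ vs) (q ∷ _) = inj₂ q
gordan {suc d} {Q} cone vs qs with gordan cone′ (zer ++ cartesianProductWith (Vec.zipWith ℚ._+_) pos neg) elim∈
  where
  open Split (split cone vs qs)
  cone′ : IsCone (λ v → Q (0ℚ ∷ v))
  cone′ = record
    { add   = IsCone.add cone
    ; scale = λ {c} {v} 0<c q → subst (λ b → Q (b ∷ Vec.map (c ℚ.*_) v)) (ℚₚ.*-zeroʳ c) (IsCone.scale cone 0<c q)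
    }
  -- Leading coordinates 1 and -1 add up to a term that computes to `0ℚ`, so each sum lies in the
  -- cone of one dimension less.
  elim∈ : All (λ v → Q (0ℚ ∷ v)) (zer ++ cartesianProductWith (Vec.zipWith ℚ._+_) pos neg)
  elim∈ = Allₚ.++⁺ zer∈ (Allₚ.cartesianProductWith⁺ (setoid _) (setoid _) (Vec.zipWith ℚ._+_) pos neg
    λ p∈ n∈ → IsCone.add cone (All.lookup pos∈ p∈) (All.lookup neg∈ n∈))
... | inj₂ q          = inj₂ q
... | inj₁ (y , y>0)  =
  -- Positivity of y on p + q says that the lower bound -(y ∙ p) lies below the upper bound y ∙ q,
  -- so some c fits between all of them.
  let c , pos<c , c<neg = <-between (map (λ v → ℚ.- (y ∙ v)) pos) (map (y ∙_) neg)
        (Allₚ.map⁺ (All.tabulate λ {p} p∈ → Allₚ.map⁺ (All.tabulate λ {q} q∈ →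
          apart (y ∙ p) (y ∙ q) (subst (0ℚ <_) (∙-+ y p q)
            (All.lookup (Allₚ.++⁻ʳ zer y>0) (∈-cartesianProductWith⁺ (Vec.zipWith ℚ._+_) p∈ q∈))))))
  in inj₁ (c ∷ y , solves c y (All.map (λ {v} → positive (y ∙ v)) (Allₚ.map⁻ pos<c))
       (Allₚ.++⁻ˡ zer y>0) (Allₚ.map⁻ c<neg))
  where
  open Split (split cone vs qs)
  open ℚ-Solver
  apart : ∀ p q → 0ℚ < p ℚ.+ q → ℚ.- p < q
  apart p q 0<p+q = subst₂ _<_ (ℚₚ.+-identityʳ (ℚ.- p)) (solve 2 (λ p q → (:- p) :+ (p :+ q) := q) refl p q)
    (ℚₚ.+-monoʳ-< (ℚ.- p) 0<p+q)
  positive : ∀ p {c} → ℚ.- p < c → 0ℚ < c ℚ.+ p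
  positive p {c} -p<c = subst (_< c ℚ.+ p) (ℚₚ.+-inverseˡ p) (ℚₚ.+-monoˡ-< p -p<c)

-- Deciding membership in the hull, and convexity

difference : Point n → Point n → Vec ℚ n
difference = Vec.zipWith (λ s t → toℚ s ℚ.- toℚ t)

∙-difference : ∀ (u : Vec ℚ n) y x →
  u ∙ difference y x ≡ dot (lookup u) (coords y) ℚ.- dot (lookup u) (coords x)
∙-difference []      []      []      = refl
∙-difference (c ∷ u) (s ∷ y) (t ∷ x) = trans (cong (c ℚ.* (toℚ s ℚ.- toℚ t) ℚ.+_) (∙-difference u y x))
  (solve 5 (λ c s t p q → c :* (s :- t) :+ (p :- q) := c :* s :+ p :- (c :* t :+ q)) refl
    c (toℚ s) (toℚ t) (dot (lookup u) (coords y)) (dot (lookup u) (coords x)))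
  where open ℚ-Solver

total : List (ℚ × Point n) → ℚ
total = Σℚ proj₁

moment : Point n → List (ℚ × Point n) → Fin n → ℚ
moment x ws i = Σℚ (λ (w , y) → (toℚ (lookup y i) ℚ.- toℚ (lookup x i)) ℚ.* w) ws

rescale : ℚ → ℚ × Point n → ℚ × Point n
rescale c (w , y) = c ℚ.* w , y

Weighted : Subset n → List (ℚ × Point n) → Set
Weighted S = All (λ (w , y) → 0ℚ ≤ w × S y ≡ true)

rescale-weighted : ∀ {S : Subset n} {c ws} → 0ℚ < c → Weighted S ws → Weighted S (map (rescale c) ws)
rescale-weighted {c = c} 0<c ok = Allₚ.map⁺ (All.map (λ {(w , y)} (0≤w , y∈S) →
  subst (_≤ c ℚ.* w) (ℚₚ.*-zeroʳ c)
    (ℚₚ.*-monoˡ-≤-nonNeg c {{ℚ.nonNegative (ℚₚ.<⇒≤ 0<c)}} 0≤w) , y∈S) ok)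

total-rescale : ∀ c (ws : List (ℚ × Point n)) → total (map (rescale c) ws) ≡ c ℚ.* total ws
total-rescale c ws = trans (Σℚ-map proj₁ (rescale c) ws) (Σℚ-* c proj₁ ws)

moment-rescale : ∀ c x (ws : List (ℚ × Point n)) i → moment x (map (rescale c) ws) i ≡ c ℚ.* moment x ws i
moment-rescale c x ws i =
  trans (Σℚ-map (λ (w , y) → (toℚ (lookup y i) ℚ.- toℚ (lookup x i)) ℚ.* w) (rescale c) ws)
    (trans (Σℚ-cong (λ (w , y) → solve 3 (λ d c w → d :* (c :* w) := c :* (d :* w)) refl
             (toℚ (lookup y i) ℚ.- toℚ (lookup x i)) c w) ws)
      (Σℚ-* c (λ (w , y) → (toℚ (lookup y i) ℚ.- toℚ (lookup x i)) ℚ.* w) ws))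
  where open ℚ-Solver

-- The cone generated by the vectors y - x with y in S. Positive total weight makes the case of the
-- zero vector meaningful: dividing by the total exhibits x as a convex combination.
Combination : Subset n → Point n → Vec ℚ n → Set
Combination S x v =
  ∃[ ws ] (Weighted S ws × 0ℚ < total ws × (∀ i → moment x ws i ≡ lookup v i))

combination-isCone : ∀ (S : Subset n) x → IsCone (Combination S x)
combination-isCone S x = record
  { add = λ {u} {v} (us , okᵤ , 0<us , eqᵤ) (vs , okᵥ , 0<vs , eqᵥ) →
      us ++ vs , Allₚ.++⁺ okᵤ okᵥ ,
      subst (0ℚ <_) (sym (Σℚ-++ proj₁ us vs)) (ℚₚ.+-mono-< 0<us 0<vs) ,
      λ i → trans (Σℚ-++ (λ (w , y) → (toℚ (lookup y i) ℚ.- toℚ (lookup x i)) ℚ.* w) us vs)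
        (trans (cong₂ ℚ._+_ (eqᵤ i) (eqᵥ i)) (sym (Vecₚ.lookup-zipWith ℚ._+_ i u v)))
  ; scale = λ {c} {v} 0<c (ws , ok , 0<ws , eq) →
      map (rescale c) ws , rescale-weighted 0<c ok ,
      subst₂ _<_ (ℚₚ.*-zeroʳ c) (sym (total-rescale c ws)) (ℚₚ.*-monoʳ-<-pos c {{ℚ.positive 0<c}} 0<ws) ,
      λ i → trans (moment-rescale c x ws i) (trans (cong (c ℚ.*_) (eq i)) (sym (Vecₚ.lookup-map i (c ℚ.*_) v)))
  }

combination⇒∈Conv : ∀ (S : Subset n) x → Combination S x (Vec.replicate n 0ℚ) → embed x ∈Conv S
combination⇒∈Conv {n} S x (ws , ok , 0<W , eq) =
  rational∈Conv S x (map (rescale r) ws) (rescale-weighted (ℚₚ.positive⁻¹ r {{r⁺}}) ok)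
    total≡1 λ i → begin
      Σℚ (λ (w , y) → toℚ (lookup y i) ℚ.* w) (map (rescale r) ws)
        ≡⟨ Σℚ-cong (λ (w , y) → solve 3 (λ a b w → a :* w := (a :- b) :* w :+ b :* w) refl
             (toℚ (lookup y i)) (toℚ (lookup x i)) w) (map (rescale r) ws) ⟩
      Σℚ (λ (w , y) → (toℚ (lookup y i) ℚ.- toℚ (lookup x i)) ℚ.* w ℚ.+ toℚ (lookup x i) ℚ.* w)
         (map (rescale r) ws)
        ≡⟨ Σℚ-+ (λ (w , y) → (toℚ (lookup y i) ℚ.- toℚ (lookup x i)) ℚ.* w)
             (λ (w , y) → toℚ (lookup x i) ℚ.* w) (map (rescale r) ws) ⟩
      moment x (map (rescale r) ws) i ℚ.+ Σℚ (λ (w , y) → toℚ (lookup x i) ℚ.* w) (map (rescale r) ws)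
        ≡⟨ cong₂ ℚ._+_
             (trans (moment-rescale r x ws i)
               (trans (cong (r ℚ.*_) (trans (eq i) (Vecₚ.lookup-replicate i 0ℚ))) (ℚₚ.*-zeroʳ r)))
             (trans (Σℚ-* (toℚ (lookup x i)) proj₁ (map (rescale r) ws)) (cong (toℚ (lookup x i) ℚ.*_) total≡1)) ⟩
      0ℚ ℚ.+ toℚ (lookup x i) ℚ.* 1ℚ
        ≡⟨ trans (ℚₚ.+-identityˡ _) (ℚₚ.*-identityʳ _) ⟩
      toℚ (lookup x i) ∎
  where
  open ≡-Reasoning
  open ℚ-Solver
  instance
    W⁺ : ℚ.Positive (total ws)
    W⁺ = ℚ.positive 0<W
    W≢0 : ℚ.NonZero (total ws)
    W≢0 = ℚₚ.pos⇒nonZero (total ws)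
  r : ℚ
  r = ℚ.1/ total ws
  r⁺ : ℚ.Positive r
  r⁺ = ℚₚ.1/pos⇒pos (total ws)
  total≡1 : total (map (rescale r) ws) ≡ 1ℚ
  total≡1 = trans (total-rescale r ws) (ℚₚ.*-inverseˡ (total ws))

-- Gordan's alternative for the vectors y - x with y in S: a solution separates x strictly from S,
-- and the zero vector yields rational weights.
∈Conv? : ∀ (S : Subset n) x → Dec (embed x ∈Conv S)
∈Conv? {n} S x = decide (gordan (combination-isCone S x) (map (λ y → difference y x) members)
    (Allₚ.map⁺ (All.map single (Allₚ.all-filter S? (cube n)))))
  where
  S? : ∀ y → Dec (S y ≡ true)
  S? y = S y Bool.≟ true
  members = filter S? (cube n)
  single : ∀ {y} → S y ≡ true → Combination S x (difference y x)
  single {y} y∈S = (1ℚ , y) ∷ [] , (ℚₚ.nonNegative⁻¹ 1ℚ , y∈S) ∷ [] , ℚₚ.positive⁻¹ 1ℚ , λ i →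
    trans (ℚₚ.+-identityʳ _) (trans (ℚₚ.*-identityʳ _)
      (sym (Vecₚ.lookup-zipWith (λ s t → toℚ s ℚ.- toℚ t) i y x)))
  decide : (∃[ u ] All (λ v → 0ℚ < u ∙ v) (map (λ y → difference y x) members))
           ⊎ Combination S x (Vec.replicate n 0ℚ) → Dec (embed x ∈Conv S)
  decide (inj₂ c)         = yes (combination⇒∈Conv S x c)
  decide (inj₁ (u , pos)) = no (separated⇒∉Conv {S = S} {x} (lookup u) λ y y∈S →
    subst₂ _<_ (ℚₚ.+-identityʳ _) (p+[q-p]≡q (dot (lookup u) (coords x)) (dot (lookup u) (coords y)))
      (ℚₚ.+-monoʳ-< (dot (lookup u) (coords x)) (subst (0ℚ <_) (∙-difference u y x)
        (All.lookup pos (∈-map⁺ (λ y → difference y x) (∈-filter⁺ S? (∈-cube y) y∈S))))))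

true≢false : true ≢ false
true≢false ()

-- S always lies in its hull, so only a hull point outside S can violate convexity, and the cube is
-- finite.
convex? : ∀ (S : Subset n) → Dec (Convex S)
convex? {n} S = decide (any? (λ x → (S x Bool.≟ false) ×-dec ∈Conv? S x) (cube n))
  where
  decide : Dec (Any (λ x → S x ≡ false × embed x ∈Conv S) (cube n)) → Dec (Convex S)
  decide (yes p) = no λ S-convex →
    let x , x∉S , x∈Conv = satisfied p
    in true≢false (trans (sym (Equivalence.from (S-convex x) x∈Conv)) x∉S)
  decide (no ¬p) = yes (convex λ x x∉S x∈Conv → ¬p (lose (∈-cube x) (x∉S , x∈Conv)))

-- Stands in for function extensionality: the set rebuilt from samples agrees with S only pointwise.
convex-resp : ∀ {S T : Subset n} → (∀ x → S x ≡ T x) → Convex S → Convex T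
convex-resp {S = S} {T} S≗T S-convex x = mk⇔ (⊆Conv T x) from
  where
  from : embed x ∈Conv T → T x ≡ true
  from (ws , ok , rest) = trans (sym (S≗T x)) (Equivalence.from (S-convex x)
    (ws , All.map (λ {(w , y)} (0≤w , y∈T) → 0≤w , trans (S≗T y) y∈T) ok , rest))

-- The lower bound

farSet : ∀ {n} → Subset (suc n)
farSet (0ₜ ∷ _) = false
farSet (_ ∷ _)  = true

farSet-line : ∀ (T : Subset (suc n)) → Convex T → ∀ y →
  1 ℕ.≤ 𝟙 ((farSet △ T) (−1ₜ ∷ y)) + (𝟙 ((farSet △ T) (0ₜ ∷ y)) + 𝟙 ((farSet △ T) (+1ₜ ∷ y)))
farSet-line T T-convex y = pattern-differs (T (−1ₜ ∷ y)) (T (0ₜ ∷ y)) (T (+1ₜ ∷ y)) λ −y∈T 0y∉T +y∈T →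
  true≢false (trans (sym (Equivalence.from (T-convex (0ₜ ∷ y)) (midpoint∈Conv T y −y∈T +y∈T))) 0y∉T)
  where
  pattern-differs : ∀ a b c → (a ≡ true → b ≡ false → c ≢ true) →
                    1 ℕ.≤ 𝟙 (true xor a) + (𝟙 (false xor b) + 𝟙 (true xor c))
  pattern-differs false _     _     _ = s≤s z≤n
  pattern-differs true  true  _     _ = s≤s z≤n
  pattern-differs true  false false _ = s≤s z≤n
  pattern-differs true  false true  h = ⊥-elim (h refl refl refl)

farSet-dist : ∀ n (T : Subset (suc n)) → Convex T → 3 ^ suc n ℕ.≤ 3 * size (farSet △ T)
farSet-dist n T T-convex = ℕₚ.*-monoʳ-≤ 3 (begin
  3 ^ n
    ≡⟨ length-cube n ⟨
  length (cube n)
    ≡⟨ ℕₚ.*-identityʳ _ ⟨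
  length (cube n) * 1
    ≡⟨ ∑-const (cube n) 1 ⟨
  ∑ (cube n) (λ _ → 1)
    ≤⟨ ∑-mono (cube n) (farSet-line T T-convex) ⟩
  ∑ (cube n) (λ y → F (−1ₜ ∷ y) + (F (0ₜ ∷ y) + F (+1ₜ ∷ y)))
    ≡⟨ trans (∑-+ (cube n) _ _) (cong (∑ (cube n) (F ∘ (−1ₜ ∷_)) +_) (∑-+ (cube n) _ _)) ⟩
  ∑ (cube n) (F ∘ (−1ₜ ∷_)) + (∑ (cube n) (F ∘ (0ₜ ∷_)) + ∑ (cube n) (F ∘ (+1ₜ ∷_)))
    ≡⟨ ∑-cube-suc n F ⟨
  ∑ (cube (suc n)) F
    ≡⟨ length-filterᵇ (farSet △ T) (cube (suc n)) ⟨
  size (farSet △ T) ∎)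
  where
  open ℕₚ.≤-Reasoning
  F : Point (suc n) → ℕ
  F x = 𝟙 ((farSet △ T) x)

⅓ ⅔ : ℚ
⅓ = ℤ.+ 1 ℚ./ 3
⅔ = ℤ.+ 2 ℚ./ 3

farSet-far : ∀ n {ε} → ε ≤ℝ fromℚ ⅓ → Far ε (farSet {n})
farSet-far n {ε} ε≤⅓ T T-convex = ≤ℝ-trans {ε} {fromℚ ⅓} {fromℚ (dist farSet T)} ε≤⅓
  (fromℚ-mono {⅓} {dist farSet T} (≤-/⁺ (size (farSet △ T)) (3 ^ suc n) {{ℕₚ.m^n≢0 3 (suc n)}} (begin
    ⅓ ℚ.* ι (3 ^ suc n)
      ≤⟨ ℚₚ.*-monoˡ-≤-nonNeg ⅓ (ι-mono (farSet-dist n T T-convex)) ⟩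
    ⅓ ℚ.* ι (3 * size (farSet △ T))
      ≡⟨ cong (⅓ ℚ.*_) (ι-* 3 (size (farSet △ T))) ⟩
    ⅓ ℚ.* (ι 3 ℚ.* ι (size (farSet △ T)))
      ≡⟨ ℚₚ.*-assoc ⅓ (ι 3) (ι (size (farSet △ T))) ⟨
    ⅓ ℚ.* ι 3 ℚ.* ι (size (farSet △ T))
      ≡⟨ ℚₚ.*-identityˡ (ι (size (farSet △ T))) ⟩
    ι (size (farSet △ T)) ∎)))
  where open ℚₚ.≤-Reasoning

-- On the cube, Σ q_i z_i attains its maximum |supp q| exactly where q ⊑ z.
normal : Point n → Fin n → ℚ
normal q i = ℚ.- coords q i

-- The sign in `normal` makes the face the minimum, since `separated⇒∉Conv` wants the excluded point
-- below the set.
face-≤ : ∀ (q x y : Point n) → q ⊑ x ≡ true → dot (normal q) (coords x) ≤ dot (normal q) (coords y)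
face-≤ []      []      []      _   = ℚₚ.≤-refl
face-≤ (s ∷ q) (t ∷ x) (t′ ∷ y) q⊑x =
  ℚₚ.+-mono-≤ (coord s t t′ (∧-conicalˡ (extends s t) (q ⊑ x) q⊑x))
               (face-≤ q x y (∧-conicalʳ (extends s t) (q ⊑ x) q⊑x))
  where
  coord : ∀ s t t′ → extends s t ≡ true → (ℚ.- toℚ s) ℚ.* toℚ t ≤ (ℚ.- toℚ s) ℚ.* toℚ t′
  coord −1ₜ −1ₜ −1ₜ _ = toWitness {a? = _ ℚₚ.≤? _} _
  coord −1ₜ −1ₜ 0ₜ  _ = toWitness {a? = _ ℚₚ.≤? _} _
  coord −1ₜ −1ₜ +1ₜ _ = toWitness {a? = _ ℚₚ.≤? _} _
  coord 0ₜ  t   t′  _ = ℚₚ.≤-reflexive (trans (ℚₚ.*-zeroˡ (toℚ t)) (sym (ℚₚ.*-zeroˡ (toℚ t′))))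
  coord +1ₜ +1ₜ −1ₜ _ = toWitness {a? = _ ℚₚ.≤? _} _
  coord +1ₜ +1ₜ 0ₜ  _ = toWitness {a? = _ ℚₚ.≤? _} _
  coord +1ₜ +1ₜ +1ₜ _ = toWitness {a? = _ ℚₚ.≤? _} _

-- The first coordinate where y leaves q gives the strict inequality; earlier ones give equality,
-- later ones `face-≤`.
face-< : ∀ (q x y : Point n) → q ⊑ x ≡ true → q ⊑ y ≡ false →
         dot (normal q) (coords x) < dot (normal q) (coords y)
face-< []      []      []       _   ()
face-< (s ∷ q) (t ∷ x) (t′ ∷ y) q⊑x q⋢y = go (extends s t′) refl q⋢y
  where
  s⊑t = ∧-conicalˡ (extends s t) (q ⊑ x) q⊑x
  tail⊑ = ∧-conicalʳ (extends s t) (q ⊑ x) q⊑x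
  coord-< : ∀ s t t′ → extends s t ≡ true → extends s t′ ≡ false →
            (ℚ.- toℚ s) ℚ.* toℚ t < (ℚ.- toℚ s) ℚ.* toℚ t′
  coord-< −1ₜ −1ₜ 0ₜ  _ _ = toWitness {a? = _ ℚₚ.<? _} _
  coord-< −1ₜ −1ₜ +1ₜ _ _ = toWitness {a? = _ ℚₚ.<? _} _
  coord-< +1ₜ +1ₜ −1ₜ _ _ = toWitness {a? = _ ℚₚ.<? _} _
  coord-< +1ₜ +1ₜ 0ₜ  _ _ = toWitness {a? = _ ℚₚ.<? _} _
  coord-≡ : ∀ s t t′ → extends s t ≡ true → extends s t′ ≡ true →
            (ℚ.- toℚ s) ℚ.* toℚ t ≡ (ℚ.- toℚ s) ℚ.* toℚ t′
  coord-≡ −1ₜ −1ₜ −1ₜ _ _ = refl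
  coord-≡ +1ₜ +1ₜ +1ₜ _ _ = refl
  coord-≡ 0ₜ  t   t′  _ _ = trans (ℚₚ.*-zeroˡ (toℚ t)) (sym (ℚₚ.*-zeroˡ (toℚ t′)))
  go : ∀ b → extends s t′ ≡ b → b ∧ q ⊑ y ≡ false →
       dot (normal (s ∷ q)) (coords (t ∷ x)) < dot (normal (s ∷ q)) (coords (t′ ∷ y))
  go false s⋢t′ _   = ℚₚ.+-mono-<-≤ (coord-< s t t′ s⊑t s⋢t′) (face-≤ q x y tail⊑)
  go true  s⊑t′ q⋢y = ℚₚ.+-mono-≤-< (ℚₚ.≤-reflexive (coord-≡ s t t′ s⊑t s⊑t′)) (face-< q x y tail⊑ q⋢y)

Refuted : Subset n → Point n → Point n → Set
Refuted S x q = S q ≡ false × q ⊑ x ≡ true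

refuted? : ∀ (S : Subset n) (qs : List (Point n)) x → Dec (Any (Refuted S x) qs)
refuted? S qs x = any? (λ q → (S q Bool.≟ false) ×-dec (q ⊑ x Bool.≟ true)) qs

unrefuted : Subset n → List (Point n) → Subset n
unrefuted S qs x = not (does (refuted? S qs x))

unrefuted-true : ∀ (S : Subset n) qs x → unrefuted S qs x ≡ true → ¬ Any (Refuted S x) qs
unrefuted-true S qs x eq with refuted? S qs x
... | no ¬r = ¬r

unrefuted-false : ∀ (S : Subset n) qs x → unrefuted S qs x ≡ false → Any (Refuted S x) qs
unrefuted-false S qs x eq with refuted? S qs x
... | yes r = r

-- A point x outside the set is refuted by some q. The face of q costs no point of the set, because
-- any y with q ⊑ y is itself refuted.
unrefuted-convex : ∀ (S : Subset n) qs → Convex (unrefuted S qs)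
unrefuted-convex S qs = convex λ x x∉T →
  let q , q∈qs , q∉S , q⊑x = find (unrefuted-false S qs x x∉T)
  in separated⇒∉Conv {S = unrefuted S qs} {x} (normal q) λ y y∈T →
       face-< q x y q⊑x (¬-not λ q⊑y → unrefuted-true S qs y y∈T (lose q∈qs (q∉S , q⊑y)))

incomparable : ∀ (xs : Vec (Point n) m) → comparablePairs xs ≡ 0 → ∀ {p q} →
               p ∈ toList xs → q ∈ toList xs → p ⊑ q ≡ true → p ≡ q
incomparable (x ∷ xs) none (here refl) (here refl) _ = refl
incomparable (x ∷ xs) none {p} {q} (here refl) (there q∈) p⊑q
  with () ← trans (sym (cong 𝟙 p⊑q)) (ℕₚ.m+n≡0⇒m≡0 (𝟙 (p ⊑ q)) {𝟙 (q ⊑ p)}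
    (∑≡0⇒≡0 {f = comparable x} (ℕₚ.m+n≡0⇒m≡0 (∑ (toList xs) (comparable x)) none) q∈))
incomparable (x ∷ xs) none {p} {q} (there p∈) (here refl) p⊑q
  with () ← trans (sym (cong 𝟙 p⊑q)) (ℕₚ.m+n≡0⇒n≡0 (𝟙 (q ⊑ p)) {𝟙 (p ⊑ q)}
    (∑≡0⇒≡0 {f = comparable x} (ℕₚ.m+n≡0⇒m≡0 (∑ (toList xs) (comparable x)) none) p∈))
incomparable (x ∷ xs) none (there p∈) (there q∈) =
  incomparable xs (ℕₚ.m+n≡0⇒n≡0 (∑ (toList xs) (comparable x)) none) p∈ q∈

-- A sample outside S refutes itself by reflexivity. A sample in S could only be refuted by a
-- comparable sample, which then equals it and lies in S.
unrefuted-consistent : ∀ (S : Subset n) (xs : Vec (Point n) m) → comparablePairs xs ≡ 0 →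
                       ∀ {x} → x ∈ toList xs → unrefuted S (toList xs) x ≡ S x
unrefuted-consistent S xs none {x} x∈xs with refuted? S (toList xs) x | S x in Sx
... | yes r | false = refl
... | yes r | true  with q , q∈xs , q∉S , q⊑x ← find r
  with () ← trans (sym Sx) (trans (cong S (sym (incomparable xs none q∈xs x∈xs q⊑x))) q∉S)
... | no ¬r | true  = refl
... | no ¬r | false = ⊥-elim (¬r (lose x∈xs (Sx , ⊑-refl x)))

labelled-cong : ∀ {S T : Subset n} (xs : Vec (Point n) m) →
                (∀ {x} → x ∈ toList xs → S x ≡ T x) → labelled S xs ≡ labelled T xs
labelled-cong []       eq = refl
labelled-cong (x ∷ xs) eq = cong₂ (λ b z → (x , b) ∷ z) (eq (here refl)) (labelled-cong xs (eq ∘ there))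

-- From acceptance probabilities to counting

1-ℝ-anti : ∀ {a} p → fromℚ p ≤ℝ a → 1ℝ -ℝ a ≤ℝ fromℚ (1ℚ ℚ.- p)
1-ℝ-anti {a} p p≤a = ≤ℝ-trans {1ℝ -ℝ a} {1ℝ -ℝ fromℚ p} {fromℚ (1ℚ ℚ.- p)}
  (+ℝ-mono {1ℝ} {1ℝ} {(ℚ.- 1ℚ) · a} {(ℚ.- 1ℚ) · fromℚ p} (≤ℝ-refl 1ℝ)
    (·-antiʳ {fromℚ p} {a} (ℚ.- 1ℚ) (ℚₚ.nonPositive⁻¹ (ℚ.- 1ℚ)) p≤a))
  (pointwise-≤ (1ℝ -ℝ fromℚ p) (fromℚ (1ℚ ℚ.- p)) λ _ → ℚₚ.≤-reflexive (negate p))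
  where
  open ℚ-Solver
  negate : ∀ p → 1ℚ ℚ.+ (ℚ.- 1ℚ) ℚ.* p ≡ 1ℚ ℚ.- p
  negate = solve 1 (λ p → con 1ℚ :+ (:- con 1ℚ) :* p := con 1ℚ :- p) refl

Σℝ-upper : ∀ {f : A → ℝ} → (∀ a → f a ≤ℝ 1ℝ) → ∀ as → Σℝ f as ≤ℝ fromℚ (ι (length as))
Σℝ-upper {f = f} f≤1 []       = ≤ℝ-refl 0ℝ
Σℝ-upper {f = f} f≤1 (a ∷ as) = ≤ℝ-trans {f a +ℝ Σℝ f as} {1ℝ +ℝ fromℚ (ι (length as))} {fromℚ (ι (length (a ∷ as)))}
  (+ℝ-mono {f a} {1ℝ} {Σℝ f as} {fromℚ (ι (length as))} (f≤1 a) (Σℝ-upper {f = f} f≤1 as))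
  (pointwise-≤ (1ℝ +ℝ fromℚ (ι (length as))) (fromℚ (ι (length (a ∷ as)))) λ _ → ℚₚ.≤-refl)

-- Cancelling the upper bound for all the other terms leaves 1 as a lower bound for the chosen one.
-- This passes from acceptance with probability one to acceptance on every tuple.
Σℝ-upper-sharp : ∀ {f : A → ℝ} → (∀ a → f a ≤ℝ 1ℝ) → ∀ as → fromℚ (ι (length as)) ≤ℝ Σℝ f as →
                 ∀ {a} → a ∈ as → 1ℝ ≤ℝ f a
Σℝ-upper-sharp {f = f} f≤1 (a ∷ as) full (here refl) = +ℝ-cancelʳ {1ℝ} {f a} {fromℚ (ι (length as))}
  (≤ℝ-trans {1ℝ +ℝ fromℚ (ι (length as))} {fromℚ (ι (length (a ∷ as)))} {f a +ℝ fromℚ (ι (length as))}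
    (pointwise-≤ (1ℝ +ℝ fromℚ (ι (length as))) (fromℚ (ι (length (a ∷ as)))) λ _ → ℚₚ.≤-refl)
    (≤ℝ-trans {fromℚ (ι (length (a ∷ as)))} {f a +ℝ Σℝ f as} {f a +ℝ fromℚ (ι (length as))} full
      (+ℝ-mono {f a} {f a} {Σℝ f as} {fromℚ (ι (length as))} (≤ℝ-refl (f a)) (Σℝ-upper {f = f} f≤1 as))))
Σℝ-upper-sharp {f = f} f≤1 (a ∷ as) full (there b∈as) = Σℝ-upper-sharp {f = f} f≤1 as
  (+ℝ-cancelʳ {fromℚ (ι (length as))} {Σℝ f as} {1ℝ}
    (≤ℝ-trans {fromℚ (ι (length as)) +ℝ 1ℝ} {fromℚ (ι (length (a ∷ as)))} {Σℝ f as +ℝ 1ℝ}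
      (pointwise-≤ (fromℚ (ι (length as)) +ℝ 1ℝ) (fromℚ (ι (length (a ∷ as))))
        λ _ → ℚₚ.≤-reflexive (ℚₚ.+-comm (ι (length as)) 1ℚ))
      (≤ℝ-trans {fromℚ (ι (length (a ∷ as)))} {f a +ℝ Σℝ f as} {Σℝ f as +ℝ 1ℝ} full
        (≤ℝ-trans {f a +ℝ Σℝ f as} {1ℝ +ℝ Σℝ f as} {Σℝ f as +ℝ 1ℝ}
          (+ℝ-mono {f a} {1ℝ} {Σℝ f as} {Σℝ f as} (f≤1 a) (≤ℝ-refl (Σℝ f as)))
          (pointwise-≤ (1ℝ +ℝ Σℝ f as) (Σℝ f as +ℝ 1ℝ) λ k → ℚₚ.≤-reflexive (ℚₚ.+-comm 1ℚ (seq (Σℝ f as) k)))))))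
  b∈as

numTuples : ∀ n m → ℕ
numTuples n m = (3 ^ n) ^ m

numTuples≢0 : ∀ n m → ℕ.NonZero (numTuples n m)
numTuples≢0 n m = ℕₚ.m^n≢0 (3 ^ n) m {{ℕₚ.m^n≢0 3 n}}

1/numTuples : ∀ n m → ℚ
1/numTuples n m = ℚ._/_ (ℤ.+ 1) (numTuples n m) {{numTuples≢0 n m}}

1/numTuples-cancel : ∀ n m q → 1/numTuples n m ℚ.* q ℚ.* ι (numTuples n m) ≡ q
1/numTuples-cancel n m q = begin
  1/numTuples n m ℚ.* q ℚ.* ι (numTuples n m)
    ≡⟨ solve 3 (λ r q s → r :* q :* s := (r :* s) :* q) refl (1/numTuples n m) q (ι (numTuples n m)) ⟩
  1/numTuples n m ℚ.* ι (numTuples n m) ℚ.* q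
    ≡⟨ cong (ℚ._* q) (/-*-cancel 1 (numTuples n m) {{numTuples≢0 n m}}) ⟩
  1ℚ ℚ.* q
    ≡⟨ ℚₚ.*-identityˡ q ⟩
  q ∎
  where
  open ≡-Reasoning
  open ℚ-Solver

length-tuples-cube : ∀ n m → length (tuples (cube n) m) ≡ numTuples n m
length-tuples-cube n m = trans (length-tuples (cube n) m) (cong (_^ m) (length-cube n))

𝔼-lower : ∀ {p} (f : Vec (Point n) m → ℝ) → fromℚ p ≤ℝ 𝔼 f →
          fromℚ (p ℚ.* ι (numTuples n m)) ≤ℝ Σℝ f (tuples (cube n) m)
𝔼-lower {n} {m} {p} f p≤𝔼 = ≤ℝ-trans {fromℚ (p ℚ.* ι M)} {ι M · fromℚ p} {Σf}
  (pointwise-≤ (fromℚ (p ℚ.* ι M)) (ι M · fromℚ p) λ _ → ℚₚ.≤-reflexive (ℚₚ.*-comm p (ι M)))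
  (≤ℝ-trans {ι M · fromℚ p} {ι M · 𝔼 f} {Σf}
    (·-monoʳ {fromℚ p} {𝔼 f} (ι M) (ι≥0 M) p≤𝔼)
    (pointwise-≤ (ι M · 𝔼 f) Σf λ k → ℚₚ.≤-reflexive
      (trans (ℚₚ.*-comm (ι M) (1/numTuples n m ℚ.* seq Σf k)) (1/numTuples-cancel n m (seq Σf k)))))
  where
  M = numTuples n m
  Σf = Σℝ f (tuples (cube n) m)

accepts-convex : ∀ {ε} (A : SampleTester n m) → IsOneSidedConvexityTester ε A →
                 ∀ T → Convex T → ∀ xs → 1ℝ ≤ℝ accept A (labelled T xs)
accepts-convex {n} {m} A (sound , _) T T-convex xs =
  Σℝ-upper-sharp {f = λ xs → accept A (labelled T xs)} (λ xs → accept≤1 A (labelled T xs)) (tuples (cube n) m)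
    (subst (λ q → fromℚ q ≤ℝ Σℝ (λ xs → accept A (labelled T xs)) (tuples (cube n) m))
      (trans (ℚₚ.*-identityˡ (ι (numTuples n m))) (cong ι (sym (length-tuples-cube n m))))
      (𝔼-lower {p = 1ℚ} (λ xs → accept A (labelled T xs)) (proj₂ (sound T T-convex))))
    (∈-tuples ∈-cube xs)

-- Without comparable pairs the convex set `T` carries the same labels, so rejection has probability
-- 0. Otherwise the right side is at least 1.
reject≤comparable : ∀ {ε} (A : SampleTester n m) → IsOneSidedConvexityTester ε A → ∀ S xs →
  1ℝ -ℝ accept A (labelled S xs) ≤ℝ fromℚ (ι (comparablePairs xs))
reject≤comparable {n} {m} {ε} A tester S xs = go (comparablePairs xs) refl
  where
  T : Subset n
  T = unrefuted S (toList xs)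
  go : ∀ k → comparablePairs xs ≡ k → 1ℝ -ℝ accept A (labelled S xs) ≤ℝ fromℚ (ι k)
  go zero none = 1-ℝ-anti {accept A (labelled S xs)} 1ℚ
    (subst (λ z → 1ℝ ≤ℝ accept A z) (labelled-cong {S = T} {S} xs (unrefuted-consistent S xs none))
      (accepts-convex {ε = ε} A tester T (unrefuted-convex S (toList xs)) xs))
  go (suc k) _ = ≤ℝ-trans {1ℝ -ℝ accept A (labelled S xs)} {fromℚ (1ℚ ℚ.- 0ℚ)} {fromℚ (ι (suc k))}
    (1-ℝ-anti {accept A (labelled S xs)} 0ℚ (accept≥0 A (labelled S xs)))
    (fromℚ-mono {1ℚ ℚ.- 0ℚ} {ι (suc k)} (p≤p+q 1ℚ (ι≥0 k)))

-- This is 2/3 ≤ m² (5/9)^n with denominators cleared: rejection of `farSet` is at least 2/3 and at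
-- most the expected number of comparable pairs.
lower-bound : ∀ n m {ε} (A : SampleTester (suc n) m) → ε ≤ℝ fromℚ ⅓ → IsOneSidedConvexityTester ε A →
              2 * (3 ^ suc n * 3 ^ suc n) ℕ.≤ 3 * (m * m * 5 ^ suc n)
lower-bound n m {ε} A ε≤⅓ tester@(_ , rejects) = ℕₚ.*-cancelʳ-≤ _ _ M {{numTuples≢0 (suc n) m}} (begin
  2 * NN * M
    ≡⟨ solve 2 (λ k M → con 2 :* k :* M := k :* (con 2 :* M)) refl NN M ⟩
  NN * (2 * M)
    ≤⟨ ℕₚ.*-monoʳ-≤ NN 2M≤3B ⟩
  NN * (3 * bad)
    ≡⟨ solve 2 (λ k b → k :* (con 3 :* b) := con 3 :* (k :* b)) refl NN bad ⟩
  3 * (NN * bad)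
    ≤⟨ ℕₚ.*-monoʳ-≤ 3 (∑-comparablePairs (suc n) m) ⟩
  3 * (m * m * (5 ^ suc n * M))
    ≡⟨ solve 3 (λ m f M → con 3 :* (m :* m :* (f :* M)) := con 3 :* (m :* m :* f) :* M) refl m (5 ^ suc n) M ⟩
  3 * (m * m * 5 ^ suc n) * M ∎)
  where
  open ℕₚ.≤-Reasoning
  open ℕ-Solver
  M NN bad : ℕ
  M = numTuples (suc n) m
  NN = 3 ^ suc n * 3 ^ suc n
  bad = ∑ (tuples (cube (suc n)) m) comparablePairs
  bound : fromℚ (⅔ ℚ.* ι M) ≤ℝ fromℚ (ι bad)
  bound = ≤ℝ-trans {fromℚ (⅔ ℚ.* ι M)}
    {Σℝ (λ xs → 1ℝ -ℝ accept A (labelled farSet xs)) (tuples (cube (suc n)) m)} {fromℚ (ι bad)}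
    (𝔼-lower {p = ⅔} (λ xs → 1ℝ -ℝ accept A (labelled farSet xs)) (rejects farSet (farSet-far n {ε} ε≤⅓)))
    (≤ℝ-trans {Σℝ (λ xs → 1ℝ -ℝ accept A (labelled farSet xs)) (tuples (cube (suc n)) m)}
      {Σℝ (λ xs → fromℚ (ι (comparablePairs xs))) (tuples (cube (suc n)) m)} {fromℚ (ι bad)}
      (Σℝ-mono {f = λ xs → 1ℝ -ℝ accept A (labelled farSet xs)}
        {λ xs → fromℚ (ι (comparablePairs xs))} {tuples (cube (suc n)) m}
        (λ {xs} _ → reject≤comparable {ε = ε} A tester farSet xs))
      (subst (λ q → Σℝ (λ xs → fromℚ (ι (comparablePairs xs))) (tuples (cube (suc n)) m) ≤ℝ fromℚ q)
        (Σℚ-ι comparablePairs (tuples (cube (suc n)) m))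
        (proj₁ (Σℝ-fromℚ (λ xs → ι (comparablePairs xs)) (tuples (cube (suc n)) m)))))
  2M≤3B : 2 * M ℕ.≤ 3 * bad
  2M≤3B = ι-cancel (subst₂ _≤_
    (trans (sym (ℚₚ.*-assoc (ι 3) ⅔ (ι M))) (sym (ι-* 2 M)))
    (sym (ι-* 3 bad))
    (ℚₚ.*-monoˡ-≤-nonNeg (ι 3) (fromℚ-cancel {⅔ ℚ.* ι M} {ι bad} bound)))

-- The full-view tester

∑-tuples-1 : ∀ n m → ∑ (tuples (cube n) m) (λ _ → 1) ≡ numTuples n m
∑-tuples-1 n m = trans (∑-const (tuples (cube n) m) 1) (trans (ℕₚ.*-identityʳ _) (length-tuples-cube n m))


seen-all : ∀ (xs : Vec (Point n) m) → missing xs ≡ 0 → ∀ x → seen xs x ≡ true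
seen-all {n} xs none x = seen-true (seen xs x) (∑≡0⇒≡0 {as = cube n} {λ x → 𝟙 (not (seen xs x))} none (∈-cube x))
  where
  seen-true : ∀ b → 𝟙 (not b) ≡ 0 → b ≡ true
  seen-true true _ = refl

-- The value at an unseen point is arbitrary: `verdict` accepts incomplete samples whatever `label`
-- is.
label : Vec (Point n × Bool) m → Subset n
label []            x = false
label ((y , b) ∷ z) x = if does (x ≟ₚ y) then b else label z x

label-labelled : ∀ (S : Subset n) (xs : Vec (Point n) m) x → seen xs x ≡ true →
                 label (labelled S xs) x ≡ S x
label-labelled S (y ∷ xs) x x∈xs with x ≟ₚ y
... | yes refl = refl
... | no _     = label-labelled S xs x x∈xs

map-proj₁-labelled : ∀ (S : Subset n) (xs : Vec (Point n) m) → Vec.map proj₁ (labelled S xs) ≡ xs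
map-proj₁-labelled S []       = refl
map-proj₁-labelled S (x ∷ xs) = cong (x ∷_) (map-proj₁-labelled S xs)

complete? : (z : Vec (Point n × Bool) m) → Dec (missing (Vec.map proj₁ z) ≡ 0)
complete? z = missing (Vec.map proj₁ z) ℕ.≟ 0

-- Accepting whenever a point is missing makes the error one-sided.
verdict : Vec (Point n × Bool) m → Bool
verdict z = not (does (complete? z)) ∨ does (convex? (label z))

label-complete : ∀ (S : Subset n) (xs : Vec (Point n) m) →
                 missing (Vec.map proj₁ (labelled S xs)) ≡ 0 → ∀ x → label (labelled S xs) x ≡ S x
label-complete S xs none x = label-labelled S xs x
  (seen-all xs (trans (cong missing (sym (map-proj₁-labelled S xs))) none) x)

verdict-convex : ∀ (S : Subset n) → Convex S → (xs : Vec (Point n) m) → verdict (labelled S xs) ≡ true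
verdict-convex S S-convex xs = go (complete? (labelled S xs))
  where
  go : (d : Dec (missing (Vec.map proj₁ (labelled S xs)) ≡ 0)) →
       not (does d) ∨ does (convex? (label (labelled S xs))) ≡ true
  go (no _)     = refl
  go (yes none) = dec-true (convex? (label (labelled S xs)))
    (convex-resp {S = S} {label (labelled S xs)} (λ x → sym (label-complete S xs none x)) S-convex)

verdict-nonconvex : ∀ (S : Subset n) → ¬ Convex S → (xs : Vec (Point n) m) → missing xs ≡ 0 →
                    verdict (labelled S xs) ≡ false
verdict-nonconvex S ¬S-convex xs none = cong₂ (λ a b → not a ∨ b)
  (dec-true (complete? (labelled S xs)) none′)
  (dec-false (convex? (label (labelled S xs))) λ T-convex →
    ¬S-convex (convex-resp {S = label (labelled S xs)} {S} (label-complete S xs none′) T-convex))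
  where
  none′ : missing (Vec.map proj₁ (labelled S xs)) ≡ 0
  none′ = trans (cong missing (map-proj₁-labelled S xs)) none

acceptance : Bool → ℚ
acceptance b = if b then 1ℚ else 0ℚ

fullViewTester : ∀ n m → SampleTester n m
fullViewTester n m = record
  { accept   = λ z → fromℚ (acceptance (verdict z))
  ; accept≥0 = λ z → fromℚ-mono {0ℚ} {acceptance (verdict z)} (≥0 (verdict z))
  ; accept≤1 = λ z → fromℚ-mono {acceptance (verdict z)} {1ℚ} (≤1 (verdict z))
  }
  where
  ≥0 : ∀ b → 0ℚ ≤ acceptance b
  ≥0 true  = ℚₚ.nonNegative⁻¹ 1ℚ
  ≥0 false = ℚₚ.≤-refl
  ≤1 : ∀ b → acceptance b ≤ 1ℚ
  ≤1 true  = ℚₚ.≤-refl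
  ≤1 false = ℚₚ.nonNegative⁻¹ 1ℚ

fullViewTester-sound : ∀ n m (S : Subset n) → Convex S → PrAccept (fullViewTester n m) S ≃ℝ 1ℝ
fullViewTester-sound n m S S-convex = pointwise-≃ (PrAccept (fullViewTester n m) S) 1ℝ λ k → begin
  1/numTuples n m ℚ.* seq (Σℝ (λ xs → accept (fullViewTester n m) (labelled S xs)) (tuples (cube n) m)) k
    ≡⟨ cong (1/numTuples n m ℚ.*_) (seq-Σℝ (λ xs → accept (fullViewTester n m) (labelled S xs)) (tuples (cube n) m) k) ⟩
  1/numTuples n m ℚ.* Σℚ (λ xs → acceptance (verdict (labelled S xs))) (tuples (cube n) m)
    ≡⟨ cong (1/numTuples n m ℚ.*_) (Σℚ-cong (λ xs → cong acceptance (verdict-convex S S-convex xs)) (tuples (cube n) m)) ⟩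
  1/numTuples n m ℚ.* Σℚ (λ _ → ι 1) (tuples (cube n) m)
    ≡⟨ cong (1/numTuples n m ℚ.*_) (trans (Σℚ-ι (λ _ → 1) (tuples (cube n) m)) (cong ι (∑-tuples-1 n m))) ⟩
  1/numTuples n m ℚ.* ι (numTuples n m)
    ≡⟨ /-*-cancel 1 (numTuples n m) {{numTuples≢0 n m}} ⟩
  1ℚ ∎
  where open ≡-Reasoning

-- For every tuple, rejection plus the number of missing points is at least 1. Averaging, rejection
-- has probability at least 1 - 1/3.
fullViewTester-complete : ∀ n m (S : Subset n) → ¬ Convex S →
  3 * ∑ (tuples (cube n) m) missing ℕ.≤ numTuples n m →
  fromℚ ⅔ ≤ℝ PrReject (fullViewTester n m) S
fullViewTester-complete n m S ¬S-convex few =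
  pointwise-≤ (fromℚ ⅔) (PrReject (fullViewTester n m) S) λ k →
    subst (λ q → ⅔ ≤ 1/numTuples n m ℚ.* q)
      (sym (seq-Σℝ (λ xs → 1ℝ -ℝ accept (fullViewTester n m) (labelled S xs)) (tuples (cube n) m) k))
      (ℚₚ.*-cancelʳ-≤-pos (ι M) {{ι-pos M {{numTuples≢0 n m}}}}
        (subst (⅔ ℚ.* ι M ≤_) (sym (1/numTuples-cancel n m R)) ⅔M≤R))
  where
  M X : ℕ
  M = numTuples n m
  X = ∑ (tuples (cube n) m) missing
  rejection : Vec (Point n) m → ℚ
  rejection xs = 1ℚ ℚ.+ (ℚ.- 1ℚ) ℚ.* acceptance (verdict (labelled S xs))
  R : ℚ
  R = Σℚ rejection (tuples (cube n) m)
  rejection≥0 : ∀ b → 0ℚ ≤ 1ℚ ℚ.+ (ℚ.- 1ℚ) ℚ.* acceptance b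
  rejection≥0 true  = ℚₚ.≤-refl
  rejection≥0 false = ℚₚ.nonNegative⁻¹ 1ℚ
  pointwise : ∀ xs k → missing xs ≡ k → ι 1 ≤ rejection xs ℚ.+ ι k
  pointwise xs zero none = ℚₚ.≤-reflexive (sym
    (cong (λ b → 1ℚ ℚ.+ (ℚ.- 1ℚ) ℚ.* acceptance b ℚ.+ 0ℚ) (verdict-nonconvex S ¬S-convex xs none)))
  pointwise xs (suc k) _ = ℚₚ.+-mono-≤ (rejection≥0 (verdict (labelled S xs))) (ι-mono {1} {suc k} (s≤s z≤n))
  ιM≤R+ιX : ι M ≤ R ℚ.+ ι X
  ιM≤R+ιX = begin
    ι M
      ≡⟨ trans (Σℚ-ι (λ _ → 1) (tuples (cube n) m)) (cong ι (∑-tuples-1 n m)) ⟨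
    Σℚ (λ _ → ι 1) (tuples (cube n) m)
      ≤⟨ Σℚ-mono (λ xs → pointwise xs (missing xs) refl) (tuples (cube n) m) ⟩
    Σℚ (λ xs → rejection xs ℚ.+ ι (missing xs)) (tuples (cube n) m)
      ≡⟨ Σℚ-+ rejection (λ xs → ι (missing xs)) (tuples (cube n) m) ⟩
    R ℚ.+ Σℚ (λ xs → ι (missing xs)) (tuples (cube n) m)
      ≡⟨ cong (R ℚ.+_) (Σℚ-ι missing (tuples (cube n) m)) ⟩
    R ℚ.+ ι X ∎
    where open ℚₚ.≤-Reasoning
  ιX≤⅓ιM : ι X ≤ ⅓ ℚ.* ι M
  ιX≤⅓ιM = begin
    ι X                   ≡⟨ ℚₚ.*-identityˡ (ι X) ⟨
    ⅓ ℚ.* ι 3 ℚ.* ι X     ≡⟨ ℚₚ.*-assoc ⅓ (ι 3) (ι X) ⟩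
    ⅓ ℚ.* (ι 3 ℚ.* ι X)   ≡⟨ cong (⅓ ℚ.*_) (ι-* 3 X) ⟨
    ⅓ ℚ.* ι (3 * X)       ≤⟨ ℚₚ.*-monoˡ-≤-nonNeg ⅓ (ι-mono few) ⟩
    ⅓ ℚ.* ι M             ∎
    where open ℚₚ.≤-Reasoning
  ⅔M≤R : ⅔ ℚ.* ι M ≤ R
  ⅔M≤R = begin
    ⅔ ℚ.* ι M
      ≡⟨ solve 1 (λ x → con ⅔ :* x := x :- con ⅓ :* x) refl (ι M) ⟩
    ι M ℚ.- ⅓ ℚ.* ι M
      ≤⟨ ℚₚ.+-mono-≤ ιM≤R+ιX (ℚₚ.neg-antimono-≤ ιX≤⅓ιM) ⟩
    R ℚ.+ ι X ℚ.- ι X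
      ≡⟨ solve 2 (λ r x → r :+ x :- x := r) refl R (ι X) ⟩
    R ∎
    where
    open ℚₚ.≤-Reasoning
    open ℚ-Solver

dist-self : ∀ (S : Subset n) → dist S S ≡ 0ℚ
dist-self {n} S = trans (cong (λ k → ℚ._/_ (ℤ.+ k) (3 ^ n) {{ℕₚ.m^n≢0 3 n}}) size≡0)
                        (ℚₚ.0/n≡0 (3 ^ n) {{ℕₚ.m^n≢0 3 n}})
  where
  size≡0 : size (S △ S) ≡ 0
  size≡0 = trans (length-filterᵇ (S △ S) (cube n))
    (trans (∑-cong (cube n) (λ x → cong 𝟙 (xor-same (S x))))
      (trans (∑-const (cube n) 0) (ℕₚ.*-zeroʳ (length (cube n)))))

-- A convex S has distance 0 to itself, which contradicts 0 < ε.
far⇒¬convex : ∀ {ε} {S : Subset n} → 0ℝ <ℝ ε → Far ε S → ¬ Convex S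
far⇒¬convex {ε = ε} {S} (δ , 0<δ , N , bound) far S-convex = ℚₚ.<-irrefl refl (ℚₚ.<-≤-trans 0<δ
  (fromℚ-cancel {δ} {0ℚ} (≤ℝ-trans {fromℚ δ} {ε} {fromℚ 0ℚ} δ≤ε
    (subst (λ q → ε ≤ℝ fromℚ q) (dist-self S) (far S S-convex)))))
  where
  δ≤ε : fromℚ δ ≤ℝ ε
  δ≤ε η 0<η = N , λ i N≤i → ℚₚ.≤-trans (subst (_≤ seq ε i) (ℚₚ.+-identityˡ δ) (bound i N≤i))
    (p≤p+q (seq ε i) (ℚₚ.<⇒≤ 0<η))

few-missing : ∀ n → 2 ℕ.≤ n →
  3 * ∑ (tuples (cube n) (3 ^ n * 3 ^ n)) missing ℕ.≤ numTuples n (3 ^ n * 3 ^ n)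
few-missing n 2≤n = ℕₚ.≤-trans (ℕₚ.≤-reflexive (cong (3 *_) (∑-missing k (3 ^ n * 3 ^ n) 3^n≡)))
  (subst (λ N → 3 * (N * k ^ (N * N)) ℕ.≤ N ^ (N * N)) (sym 3^n≡) (coupon-collector k 4≤))
  where
  k : ℕ
  k = ℕ.pred (3 ^ n)
  3^n≡ : 3 ^ n ≡ suc k
  3^n≡ = sym (ℕₚ.suc-pred (3 ^ n) {{ℕₚ.m^n≢0 3 n}})
  4≤ : 4 ℕ.≤ suc k
  4≤ = subst (4 ℕ.≤_) 3^n≡ (ℕₚ.≤-trans (ℕₚ.m≤m+n 4 5) (ℕₚ.^-monoʳ-≤ 3 2≤n))

theorem1p11 : ∃[ ε₀ ] (0ℝ <ℝ ε₀ ×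
    (∀ (ε : ℝ) → 0ℝ <ℝ ε → ε ≤ℝ ε₀ →
    ∃[ c ] ∃[ C ] ∃[ n₀ ] (0ℚ < c × c ≤ C ×
    (∀ (n : ℕ) → n ≥ n₀ →
    (∀ (m : ℕ) (A : SampleTester n m) → IsOneSidedConvexityTester ε A → 3^⟨ c * n ⟩≤ m)
    × (∃[ m ] (m ≤3^⟨ C * n ⟩ × (Σ (SampleTester n m) λ A → IsOneSidedConvexityTester ε A)))))))
theorem1p11 = fromℚ ⅓ , (⅓ , ℚₚ.positive⁻¹ ⅓ , 0 , λ _ _ → ℚₚ.≤-refl) , λ ε 0<ε ε≤⅓ →
  -- c = 1/6 from `3^n≤m^6`, C = 2 from the 3^n · 3^n = 3^(2n) samples, n₀ = 2 from
  -- `27*375^n≤8*729^n`; `few-missing` also asks for n ≥ 2, so that 3^n ≥ 4.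
  ℤ.+ 1 ℚ./ 6 , ℤ.+ 2 ℚ./ 1 , 2 ,
  ℚₚ.positive⁻¹ (ℤ.+ 1 ℚ./ 6) , toWitness {a? = (ℤ.+ 1 ℚ./ 6) ℚₚ.≤? (ℤ.+ 2 ℚ./ 1)} _ ,
  λ n 2≤n → lower ε ε≤⅓ n 2≤n , 3 ^ n * 3 ^ n , few n , fullViewTester n (3 ^ n * 3 ^ n) ,
    fullViewTester-sound n (3 ^ n * 3 ^ n) ,
    λ S far → fullViewTester-complete n (3 ^ n * 3 ^ n) S (far⇒¬convex {ε = ε} {S} 0<ε far) (few-missing n 2≤n)
  where
  lower : ∀ ε → ε ≤ℝ fromℚ ⅓ → ∀ n → 2 ℕ.≤ n → ∀ m (A : SampleTester n m) →
          IsOneSidedConvexityTester ε A → 3 ^ (1 * n) ℕ.≤ m ^ 6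
  lower ε ε≤⅓ (suc n) 2≤n m A tester =
    subst (λ k → 3 ^ k ℕ.≤ m ^ 6) (sym (ℕₚ.*-identityˡ (suc n)))
      (3^n≤m^6 (suc n) m 2≤n (lower-bound n m {ε} A ε≤⅓ tester))
  few : ∀ n → (3 ^ n * 3 ^ n) ^ 1 ℕ.≤ 3 ^ (2 * n)
  few n = ℕₚ.≤-reflexive (trans (ℕₚ.*-identityʳ (3 ^ n * 3 ^ n))
    (trans (sym (ℕₚ.^-distribˡ-+-* 3 n n)) (cong (λ k → 3 ^ (n + k)) (sym (ℕₚ.+-identityʳ n)))))
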